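{- Let $a$ be a nonzero complex number. For all integers $n\ge 1$ and $m\ge 0$, $$S_2(n,m)=\sum_{m\le l\le n}\binom{ -an}{n-l}(n-1)_{n-l}\binom{l-1}{m-1}B_{l-m}^{(l-m-n+1)}(an+1).$$
   Context: For any integer $r$ (positive, zero or negative), the Bernoulli polynomials of order $r$ are defined by $\left(\frac{t}{e^t-1}\right)^r e^{xt}=\sum_{k=0}^{\infty}B_k^{(r)}(x)\frac{t^k}{k!}$. $S_2(n,m)$ denotes the Stirling numbers of the second kind ($S_2(n,m)=0$ for $m>n$). $(y)_j=y(y-1)\cdots(y-j+1)$ is the falling factorial, $(y)_0=1$, and $\binom{y}{j}=\frac{(y)_j}{j!}$ for complex $y$ and integer $j\ge 0$, while $\binom{y}{j}=0$ for integers $j<0$. An empty sum is $0$. -}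

module Defs where

open import Algebra.Bundles using (CommutativeRing)
open import Algebra.Morphism.Structures using (IsRingHomomorphism)
open import Data.Fin.Base using (zero; suc; toℕ)
open import Data.Integer.Base as ℤ using (ℤ; +_; -[1+_])
open import Data.Nat.Base as ℕ using (ℕ; zero; suc; _∸_; _!; _⊔_)
import Data.Nat.Properties as ℕₚ
open import Data.Product.Base using (∃-syntax; _×_; _,_; proj₁; proj₂)
open import Data.Rational.Base as ℚ using (ℚ; 0ℚ; 1ℚ; ½; ∣_∣; _<_)
import Data.Rational.Properties as ℚₚ
open import Data.Vec.Functional using (Vector)
import Data.Vec.Functional as Vector
open import Level using (0ℓ)
open import Relation.Binary.PropositionalEquality as ≡ using (_≡_)
open import Relation.Binary.Structures using (IsEquivalence)
open import Relation.Nullary.Decidable.Core using (dec⇒maybe)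
open import Tactic.RingSolver using (solve-∀)
open import Tactic.RingSolver.Core.AlmostCommutativeRing using (AlmostCommutativeRing; fromCommutativeRing)

private
  ringℚ : AlmostCommutativeRing 0ℓ 0ℓ
  ringℚ = fromCommutativeRing ℚₚ.+-*-commutativeRing (λ q → dec⇒maybe (0ℚ ℚₚ.≟ q))

  module Estimates where
    open import Data.Rational.Base using (_+_; _*_; _-_; -_; Positive)
    open ℚₚ.≤-Reasoning

    ∣x-x∣<ε : ∀ {x y ε} → 0ℚ < ε → x ≡ y → ∣ x - y ∣ < ε
    ∣x-x∣<ε {x} 0<ε ≡.refl rewrite ℚₚ.+-inverseʳ x = 0<ε

    half : ∀ {ε} → 0ℚ < ε → 0ℚ < ½ * ε
    half {ε} 0<ε = ℚₚ.positive⁻¹ (½ * ε)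
      {{ℚₚ.pos*pos⇒pos ½ ε {{ℚ.positive 0<ε}}}}

    halves : ∀ ε → ½ * ε + ½ * ε ≡ ε
    halves ε = ≡.trans (≡.sym (ℚₚ.*-distribʳ-+ ε ½ ½)) (ℚₚ.*-identityˡ ε)

    triangle : ∀ {p q r ε} → r ≡ p + q → ∣ p ∣ < ½ * ε → ∣ q ∣ < ½ * ε → ∣ r ∣ < ε
    triangle {p} {q} {r} {ε} ≡.refl p< q< = begin-strict
      ∣ p + q ∣       ≤⟨ ℚₚ.∣p+q∣≤∣p∣+∣q∣ p q ⟩
      ∣ p ∣ + ∣ q ∣   <⟨ ℚₚ.+-mono-< p< q< ⟩
      ½ * ε + ½ * ε   ≡⟨ halves ε ⟩
      ε               ∎

    dist-sym : ∀ x y {ε} → ∣ x - y ∣ < ε → ∣ y - x ∣ < ε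
    dist-sym x y {ε} = ≡.subst (_< ε)
      (≡.trans (≡.sym (ℚₚ.∣-p∣≡∣p∣ (x - y))) (≡.cong ∣_∣ (lemma x y)))
      where
      lemma : ∀ x y → - (x - y) ≡ y - x
      lemma = solve-∀ ringℚ

    dist-trans : ∀ x y z {ε} → ∣ x - y ∣ < ½ * ε → ∣ y - z ∣ < ½ * ε → ∣ x - z ∣ < ε
    dist-trans x y z = triangle (lemma x y z)
      where
      lemma : ∀ x y z → x - z ≡ (x - y) + (y - z)
      lemma = solve-∀ ringℚ

    dist-+ : ∀ a b c d {ε} → ∣ a - c ∣ < ½ * ε → ∣ b - d ∣ < ½ * ε →
             ∣ (a + b) - (c + d) ∣ < ε
    dist-+ a b c d = triangle (lemma a b c d)
      where
      lemma : ∀ a b c d → (a + b) - (c + d) ≡ (a - c) + (b - d)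
      lemma = solve-∀ ringℚ

    dist-neg : ∀ a b {ε} → ∣ a - b ∣ < ε → ∣ (- a) - (- b) ∣ < ε
    dist-neg a b {ε} a-b< = ≡.subst (λ p → ∣ p ∣ < ε) (lemma a b) (dist-sym a b a-b<)
      where
      lemma : ∀ a b → b - a ≡ (- a) - (- b)
      lemma = solve-∀ ringℚ

    private
      scale : ∀ {p q δ K ε} → 0ℚ < K → δ * K ≡ ε → ∣ p ∣ < δ → ∣ q ∣ < K → ∣ p * q ∣ < ε
      scale {p} {q} {δ} {K} {ε} 0<K δK≡ε p< q< = begin-strict
        ∣ p * q ∣      ≡⟨ ℚₚ.∣p*q∣≡∣p∣*∣q∣ p q ⟩
        ∣ p ∣ * ∣ q ∣  ≤⟨ ℚₚ.*-monoˡ-≤-nonNeg ∣ p ∣ {{ℚₚ.∣-∣-nonNeg p}} (ℚₚ.<⇒≤ q<) ⟩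
        ∣ p ∣ * K      <⟨ ℚₚ.*-monoˡ-<-pos K {{ℚ.positive 0<K}} p< ⟩
        δ * K          ≡⟨ δK≡ε ⟩
        ε              ∎

    dist-* : ∀ a b c d {δ K ε} → 0ℚ < K → δ * K ≡ ½ * ε →
             ∣ b ∣ < K → ∣ c ∣ < K → ∣ a - c ∣ < δ → ∣ b - d ∣ < δ →
             ∣ a * b - c * d ∣ < ε
    dist-* a b c d 0<K δK b< c< a-c< b-d< = triangle (lemma a b c d)
      (scale {a - c} {b} 0<K δK a-c< b<) (scale {b - d} {c} 0<K δK b-d< c<)
      where
      lemma : ∀ a b c d → a * b - c * d ≡ (a - c) * b + (b - d) * c
      lemma = solve-∀ ringℚ

    quotient : ∀ {ε K} → 0ℚ < ε → 0ℚ < K → ∃[ δ ] (0ℚ < δ × δ * K ≡ ε)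
    quotient {ε} {K} 0<ε 0<K = ε * 1/K , ℚₚ.positive⁻¹ (ε * 1/K) , (begin-equality
      ε * 1/K * K    ≡⟨ ℚₚ.*-assoc ε 1/K K ⟩
      ε * (1/K * K)  ≡⟨ ≡.cong (ε *_) (ℚₚ.*-inverseˡ K) ⟩
      ε * 1ℚ         ≡⟨ ℚₚ.*-identityʳ ε ⟩
      ε              ∎)
      where
      instance
        K>0 : Positive K
        K>0 = ℚ.positive 0<K
        K≢0 : ℚ.NonZero K
        K≢0 = ℚₚ.pos⇒nonZero K
      1/K : ℚ
      1/K = ℚ.1/ K
      instance
        ε/K>0 : Positive (ε * 1/K)
        ε/K>0 = ℚₚ.pos*pos⇒pos ε {{ℚ.positive 0<ε}} 1/K {{ℚₚ.1/pos⇒pos K}}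

    0<∣_∣+1 : ∀ x → 0ℚ < ∣ x ∣ + 1ℚ
    0<∣ x ∣+1 = ℚₚ.positive⁻¹ (∣ x ∣ + 1ℚ) {{ℚₚ.nonNeg+pos⇒pos ∣ x ∣ {{ℚₚ.∣-∣-nonNeg x}} 1ℚ}}

    bound : ∀ x y → ∣ y - x ∣ < 1ℚ → ∣ y ∣ < ∣ x ∣ + 1ℚ
    bound x y y-x< = begin-strict
      ∣ y ∣              ≡⟨ ≡.cong ∣_∣ (lemma x y) ⟩
      ∣ x + (y - x) ∣    ≤⟨ ℚₚ.∣p+q∣≤∣p∣+∣q∣ x (y - x) ⟩
      ∣ x ∣ + ∣ y - x ∣  <⟨ ℚₚ.+-monoʳ-< ∣ x ∣ y-x< ⟩
      ∣ x ∣ + 1ℚ         ∎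
      where
      lemma : ∀ x y → y ≡ x + (y - x)
      lemma = solve-∀ ringℚ

  open Estimates

  ⊔ˡ : ∀ {i n} j → i ⊔ j ℕ.≤ n → i ℕ.≤ n
  ⊔ˡ {i} j = ℕₚ.m⊔n≤o⇒m≤o i j

  ⊔ʳ : ∀ i {j n} → i ⊔ j ℕ.≤ n → j ℕ.≤ n
  ⊔ʳ i {j} = ℕₚ.m⊔n≤o⇒n≤o i j

-- Cauchy sequences of rationals, considered up to _≈ℝ_. The moduli of convergence
-- are part of the data.
record ℝ : Set where
  no-eta-equality
  field
    seq    : ℕ → ℚ
    cauchy : ∀ {ε} → 0ℚ < ε →
             ∃[ N ] (∀ m n → N ℕ.≤ m → N ℕ.≤ n → ∣ seq m ℚ.- seq n ∣ < ε)

open ℝ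

infix 4 _≈ℝ_

record _≈ℝ_ (x y : ℝ) : Set where
  constructor mk≈
  field
    close : ∀ {ε} → 0ℚ < ε →
            ∃[ N ] (∀ n → N ℕ.≤ n → ∣ seq x n ℚ.- seq y n ∣ < ε)

open _≈ℝ_

ℚ⇒ℝ : ℚ → ℝ
ℚ⇒ℝ q .seq _      = q
ℚ⇒ℝ q .cauchy 0<ε = 0 , λ _ _ _ _ → ∣x-x∣<ε {q} 0<ε ≡.refl

private
  pointwise : ∀ {x y} → (∀ n → seq x n ≡ seq y n) → x ≈ℝ y
  pointwise {x} eq = mk≈ λ 0<ε → 0 , λ n _ → ∣x-x∣<ε {seq x n} 0<ε (eq n)

  bounded : ∀ x → ∃[ K ] (0ℚ < K × ∃[ N ] (∀ n → N ℕ.≤ n → ∣ seq x n ∣ < K))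
  bounded x =
    let N , c = cauchy x (ℚₚ.positive⁻¹ 1ℚ)
    in ∣ seq x N ∣ ℚ.+ 1ℚ , 0<∣ seq x N ∣+1 , N , λ n N≤n →
       bound (seq x N) (seq x n) (c n N N≤n ℕₚ.≤-refl)

  bounded₂ : ∀ x y → ∃[ K ] (0ℚ < K ×
             ∃[ N ] (∀ n → N ℕ.≤ n → ∣ seq x n ∣ < K × ∣ seq y n ∣ < K))
  bounded₂ x y =
    let K , 0<K , M , b = bounded x
        L , 0<L , N , c = bounded y
    in K ℚ.⊔ L , ℚₚ.<-≤-trans 0<K (ℚₚ.p≤p⊔q K L) , M ⊔ N , λ n le →
       ℚₚ.<-≤-trans (b n (⊔ˡ N le)) (ℚₚ.p≤p⊔q K L) ,
       ℚₚ.<-≤-trans (c n (⊔ʳ M le)) (ℚₚ.p≤q⊔p K L)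

infixl 6 _+ℝ_
infixl 7 _*ℝ_
infix  8 -ℝ_

_+ℝ_ : ℝ → ℝ → ℝ
(x +ℝ y) .seq n      = seq x n ℚ.+ seq y n
(x +ℝ y) .cauchy 0<ε =
  let M , c = cauchy x (half 0<ε)
      N , d = cauchy y (half 0<ε)
  in M ⊔ N , λ m n le le′ →
     dist-+ (seq x m) (seq y m) (seq x n) (seq y n)
       (c m n (⊔ˡ N le) (⊔ˡ N le′)) (d m n (⊔ʳ M le) (⊔ʳ M le′))

-ℝ_ : ℝ → ℝ
(-ℝ x) .seq n      = ℚ.- seq x n
(-ℝ x) .cauchy 0<ε =
  let N , c = cauchy x 0<ε
  in N , λ m n N≤m N≤n → dist-neg (seq x m) (seq x n) (c m n N≤m N≤n)

_*ℝ_ : ℝ → ℝ → ℝ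
(x *ℝ y) .seq n      = seq x n ℚ.* seq y n
(x *ℝ y) .cauchy 0<ε =
  let K , 0<K , L , b = bounded₂ y x
      δ , 0<δ , δK    = quotient (half 0<ε) 0<K
      M , c = cauchy x 0<δ
      N , d = cauchy y 0<δ
  in L ⊔ (M ⊔ N) , λ m n le le′ →
     dist-* (seq x m) (seq y m) (seq x n) (seq y n) 0<K δK
       (proj₁ (b m (⊔ˡ (M ⊔ N) le)))
       (proj₂ (b n (⊔ˡ (M ⊔ N) le′)))
       (c m n (⊔ˡ N (⊔ʳ L le)) (⊔ˡ N (⊔ʳ L le′)))
       (d m n (⊔ʳ M (⊔ʳ L le)) (⊔ʳ M (⊔ʳ L le′)))

private
  ≈ℝ-isEquivalence : IsEquivalence _≈ℝ_
  ≈ℝ-isEquivalence = record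
    { refl  = pointwise λ _ → ≡.refl
    ; sym   = λ {x} {y} p → mk≈ λ 0<ε →
        let N , c = close p 0<ε
        in N , λ n N≤n → dist-sym (seq x n) (seq y n) (c n N≤n)
    ; trans = λ {x} {y} {z} p q → mk≈ λ 0<ε →
        let M , c = close p (half 0<ε)
            N , d = close q (half 0<ε)
        in M ⊔ N , λ n le →
           dist-trans (seq x n) (seq y n) (seq z n) (c n (⊔ˡ N le)) (d n (⊔ʳ M le))
    }

  +ℝ-cong : ∀ {x x′ y y′} → x ≈ℝ x′ → y ≈ℝ y′ → x +ℝ y ≈ℝ x′ +ℝ y′
  +ℝ-cong {x} {x′} {y} {y′} p q = mk≈ λ 0<ε →
    let M , c = close p (half 0<ε)
        N , d = close q (half 0<ε)
    in M ⊔ N , λ n le →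
       dist-+ (seq x n) (seq y n) (seq x′ n) (seq y′ n) (c n (⊔ˡ N le)) (d n (⊔ʳ M le))

  -ℝ-cong : ∀ {x y} → x ≈ℝ y → -ℝ x ≈ℝ -ℝ y
  -ℝ-cong {x} {y} p = mk≈ λ 0<ε →
    let N , c = close p 0<ε
    in N , λ n N≤n → dist-neg (seq x n) (seq y n) (c n N≤n)

  *ℝ-cong : ∀ {x x′ y y′} → x ≈ℝ x′ → y ≈ℝ y′ → x *ℝ y ≈ℝ x′ *ℝ y′
  *ℝ-cong {x} {x′} {y} {y′} p q = mk≈ λ 0<ε →
    let K , 0<K , L , b  = bounded₂ y x′
        δ , 0<δ , δK     = quotient (half 0<ε) 0<K
        M , c = close p 0<δ
        N , d = close q 0<δ
    in L ⊔ (M ⊔ N) , λ n le →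
       dist-* (seq x n) (seq y n) (seq x′ n) (seq y′ n) 0<K δK
         (proj₁ (b n (⊔ˡ (M ⊔ N) le)))
         (proj₂ (b n (⊔ˡ (M ⊔ N) le)))
         (c n (⊔ˡ N (⊔ʳ L le)))
         (d n (⊔ʳ M (⊔ʳ L le)))

ℝ-commutativeRing : CommutativeRing 0ℓ 0ℓ
ℝ-commutativeRing = record
  { Carrier = ℝ
  ; _≈_     = _≈ℝ_
  ; _+_     = _+ℝ_
  ; _*_     = _*ℝ_
  ; -_      = -ℝ_
  ; 0#      = ℚ⇒ℝ 0ℚ
  ; 1#      = ℚ⇒ℝ 1ℚ
  ; isCommutativeRing = record
    { isRing = record
      { +-isAbelianGroup = record
        { isGroup = record
          { isMonoid = record
            { isSemigroup = record
              { isMagma = record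
                { isEquivalence = ≈ℝ-isEquivalence
                ; ∙-cong        = +ℝ-cong
                }
              ; assoc = λ x y z → pointwise λ n → ℚₚ.+-assoc (seq x n) (seq y n) (seq z n)
              }
            ; identity = (λ x → pointwise λ n → ℚₚ.+-identityˡ (seq x n))
                       , (λ x → pointwise λ n → ℚₚ.+-identityʳ (seq x n))
            }
          ; inverse = (λ x → pointwise λ n → ℚₚ.+-inverseˡ (seq x n))
                    , (λ x → pointwise λ n → ℚₚ.+-inverseʳ (seq x n))
          ; ⁻¹-cong = -ℝ-cong
          }
        ; comm = λ x y → pointwise λ n → ℚₚ.+-comm (seq x n) (seq y n)
        }
      ; *-cong     = *ℝ-cong
      ; *-assoc    = λ x y z → pointwise λ n → ℚₚ.*-assoc (seq x n) (seq y n) (seq z n)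
      ; *-identity = (λ x → pointwise λ n → ℚₚ.*-identityˡ (seq x n))
                   , (λ x → pointwise λ n → ℚₚ.*-identityʳ (seq x n))
      ; distrib    =
          (λ x y z → pointwise λ n → ℚₚ.*-distribˡ-+ (seq x n) (seq y n) (seq z n))
        , (λ x y z → pointwise λ n → ℚₚ.*-distribʳ-+ (seq x n) (seq y n) (seq z n))
      }
    ; *-comm = λ x y → pointwise λ n → ℚₚ.*-comm (seq x n) (seq y n)
    }
  }

record ℂ : Set where
  no-eta-equality
  field
    re im : ℝ

open ℂ

infix 4 _≈ℂ_

record _≈ℂ_ (z w : ℂ) : Set where
  constructor _,_
  field
    re≈ : re z ≈ℝ re w
    im≈ : im z ≈ℝ im w

open _≈ℂ_

ℚ⇒ℂ : ℚ → ℂ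
ℚ⇒ℂ q .re = ℚ⇒ℝ q
ℚ⇒ℂ q .im = ℚ⇒ℝ 0ℚ

infixl 6 _+ℂ_
infixl 7 _*ℂ_
infix  8 -ℂ_

_+ℂ_ : ℂ → ℂ → ℂ
(z +ℂ w) .re = re z +ℝ re w
(z +ℂ w) .im = im z +ℝ im w

-ℂ_ : ℂ → ℂ
(-ℂ z) .re = -ℝ re z
(-ℂ z) .im = -ℝ im z

_*ℂ_ : ℂ → ℂ → ℂ
(z *ℂ w) .re = re z *ℝ re w +ℝ -ℝ (im z *ℝ im w)
(z *ℂ w) .im = re z *ℝ im w +ℝ im z *ℝ re w

private
  module R = CommutativeRing ℝ-commutativeRing

  module ComplexLaws where
    open import Data.Rational.Base using (_+_; _*_; -_)

    assoc-re : ∀ a b c d e f →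
      (a * c + - (b * d)) * e + - ((a * d + b * c) * f)
        ≡ a * (c * e + - (d * f)) + - (b * (c * f + d * e))
    assoc-re = solve-∀ ringℚ

    assoc-im : ∀ a b c d e f →
      (a * c + - (b * d)) * f + (a * d + b * c) * e
        ≡ a * (c * f + d * e) + b * (c * e + - (d * f))
    assoc-im = solve-∀ ringℚ

    comm-re : ∀ a b c d → a * c + - (b * d) ≡ c * a + - (d * b)
    comm-re = solve-∀ ringℚ

    comm-im : ∀ a b c d → a * d + b * c ≡ c * b + d * a
    comm-im = solve-∀ ringℚ

    distribˡ-re : ∀ a b c d e f →
      a * (c + e) + - (b * (d + f)) ≡ (a * c + - (b * d)) + (a * e + - (b * f))
    distribˡ-re = solve-∀ ringℚ

    distribˡ-im : ∀ a b c d e f →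
      a * (d + f) + b * (c + e) ≡ (a * d + b * c) + (a * f + b * e)
    distribˡ-im = solve-∀ ringℚ

  open ComplexLaws

  ≈ℂ-isEquivalence : IsEquivalence _≈ℂ_
  ≈ℂ-isEquivalence = record
    { refl  = R.refl , R.refl
    ; sym   = λ p → R.sym (re≈ p) , R.sym (im≈ p)
    ; trans = λ p q → R.trans (re≈ p) (re≈ q) , R.trans (im≈ p) (im≈ q)
    }

  module ≈ℂ = IsEquivalence ≈ℂ-isEquivalence

  +ℂ-comm : ∀ z w → z +ℂ w ≈ℂ w +ℂ z
  +ℂ-comm z w = R.+-comm (re z) (re w) , R.+-comm (im z) (im w)

  *ℂ-comm : ∀ z w → z *ℂ w ≈ℂ w *ℂ z
  *ℂ-comm z w =
      (pointwise λ n → comm-re (seq (re z) n) (seq (im z) n) (seq (re w) n) (seq (im w) n))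
    , (pointwise λ n → comm-im (seq (re z) n) (seq (im z) n) (seq (re w) n) (seq (im w) n))

  *ℂ-assoc : ∀ z w v → (z *ℂ w) *ℂ v ≈ℂ z *ℂ (w *ℂ v)
  *ℂ-assoc z w v =
      (pointwise λ n → assoc-re (seq (re z) n) (seq (im z) n) (seq (re w) n) (seq (im w) n)
                                (seq (re v) n) (seq (im v) n))
    , (pointwise λ n → assoc-im (seq (re z) n) (seq (im z) n) (seq (re w) n) (seq (im w) n)
                                (seq (re v) n) (seq (im v) n))

  +ℂ-cong : ∀ {z z′ w w′} → z ≈ℂ z′ → w ≈ℂ w′ → z +ℂ w ≈ℂ z′ +ℂ w′
  +ℂ-cong p q = R.+-cong (re≈ p) (re≈ q) , R.+-cong (im≈ p) (im≈ q)

  *ℂ-cong : ∀ {z z′ w w′} → z ≈ℂ z′ → w ≈ℂ w′ → z *ℂ w ≈ℂ z′ *ℂ w′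
  *ℂ-cong p q =
      R.+-cong (R.*-cong (re≈ p) (re≈ q)) (R.-‿cong (R.*-cong (im≈ p) (im≈ q)))
    , R.+-cong (R.*-cong (re≈ p) (im≈ q)) (R.*-cong (im≈ p) (re≈ q))

  *ℂ-identityˡ : ∀ z → ℚ⇒ℂ 1ℚ *ℂ z ≈ℂ z
  *ℂ-identityˡ z =
      R.trans (R.+-cong (R.*-identityˡ (re z)) (R.trans (R.-‿cong (R.zeroˡ (im z))) -0#≈0#))
              (R.+-identityʳ (re z))
    , R.trans (R.+-cong (R.*-identityˡ (im z)) (R.zeroˡ (re z))) (R.+-identityʳ (im z))
    where open import Algebra.Properties.Ring R.ring using (-0#≈0#)

  *ℂ-distribˡ : ∀ z w v → z *ℂ (w +ℂ v) ≈ℂ z *ℂ w +ℂ z *ℂ v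
  *ℂ-distribˡ z w v =
      (pointwise λ n → distribˡ-re (seq (re z) n) (seq (im z) n) (seq (re w) n) (seq (im w) n)
                                   (seq (re v) n) (seq (im v) n))
    , (pointwise λ n → distribˡ-im (seq (re z) n) (seq (im z) n) (seq (re w) n) (seq (im w) n)
                                   (seq (re v) n) (seq (im v) n))

ℂ-commutativeRing : CommutativeRing 0ℓ 0ℓ
ℂ-commutativeRing = record
  { Carrier = ℂ
  ; _≈_     = _≈ℂ_
  ; _+_     = _+ℂ_
  ; _*_     = _*ℂ_
  ; -_      = -ℂ_
  ; 0#      = ℚ⇒ℂ 0ℚ
  ; 1#      = ℚ⇒ℂ 1ℚ
  ; isCommutativeRing = record
    { isRing = record
      { +-isAbelianGroup = record
        { isGroup = record
          { isMonoid = record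
            { isSemigroup = record
              { isMagma = record
                { isEquivalence = ≈ℂ-isEquivalence
                ; ∙-cong        = +ℂ-cong
                }
              ; assoc = λ z w v → R.+-assoc (re z) (re w) (re v) , R.+-assoc (im z) (im w) (im v)
              }
            ; identity = (λ z → R.+-identityˡ (re z) , R.+-identityˡ (im z))
                       , (λ z → R.+-identityʳ (re z) , R.+-identityʳ (im z))
            }
          ; inverse = (λ z → R.-‿inverseˡ (re z) , R.-‿inverseˡ (im z))
                    , (λ z → R.-‿inverseʳ (re z) , R.-‿inverseʳ (im z))
          ; ⁻¹-cong = λ p → R.-‿cong (re≈ p) , R.-‿cong (im≈ p)
          }
        ; comm = +ℂ-comm
        }
      ; *-cong     = *ℂ-cong
      ; *-assoc    = *ℂ-assoc
      ; *-identity = *ℂ-identityˡ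
                   , (λ z → ≈ℂ.trans (*ℂ-comm z (ℚ⇒ℂ 1ℚ)) (*ℂ-identityˡ z))
      ; distrib    = *ℂ-distribˡ
                   , (λ z w v → ≈ℂ.trans (*ℂ-comm (w +ℂ v) z)
                       (≈ℂ.trans (*ℂ-distribˡ z w v)
                         (+ℂ-cong (*ℂ-comm z w) (*ℂ-comm z v))))
      }
    ; *-comm = *ℂ-comm
    }
  }

ℚ⇒ℂ-isRingHomomorphism :
  IsRingHomomorphism ℚ.+-*-rawRing (CommutativeRing.rawRing ℂ-commutativeRing) ℚ⇒ℂ
ℚ⇒ℂ-isRingHomomorphism = record
  { isSemiringHomomorphism = record
    { isNearSemiringHomomorphism = record
      { +-isMonoidHomomorphism = record
        { isMagmaHomomorphism = record
          { isRelHomomorphism = record { cong = λ { ≡.refl → ≈ℂ.refl } }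
          ; homo = λ p q → pointwise (λ _ → ≡.refl) , R.sym (R.+-identityʳ (ℚ⇒ℝ 0ℚ))
          }
        ; ε-homo = ≈ℂ.refl
        }
      ; *-homo = λ p q → *-homo-re p q , *-homo-im p q
      }
    ; 1#-homo = ≈ℂ.refl
    }
  ; -‿homo = λ q → pointwise (λ _ → ≡.refl) , R.sym -0#≈0#
  }
  where
  open import Algebra.Properties.Ring R.ring using (-0#≈0#)

  *-homo-re : ∀ p q → ℚ⇒ℝ (p ℚ.* q) ≈ℝ ℚ⇒ℝ p *ℝ ℚ⇒ℝ q +ℝ -ℝ (ℚ⇒ℝ 0ℚ *ℝ ℚ⇒ℝ 0ℚ)
  *-homo-re p q = R.sym (R.trans
    (R.+-cong (pointwise λ _ → ≡.refl) (R.trans (R.-‿cong (R.zeroˡ (ℚ⇒ℝ 0ℚ))) -0#≈0#))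
    (R.+-identityʳ (ℚ⇒ℝ (p ℚ.* q))))

  *-homo-im : ∀ p q → ℚ⇒ℝ 0ℚ ≈ℝ ℚ⇒ℝ p *ℝ ℚ⇒ℝ 0ℚ +ℝ ℚ⇒ℝ 0ℚ *ℝ ℚ⇒ℝ q
  *-homo-im p q = R.sym (R.trans
    (R.+-cong (R.zeroʳ (ℚ⇒ℝ p)) (R.zeroˡ (ℚ⇒ℝ q)))
    (R.+-identityʳ (ℚ⇒ℝ 0ℚ)))

-- Stirling numbers of the second kind
S₂ : ℕ → ℕ → ℕ
S₂ zero    zero    = 1
S₂ zero    (suc m) = 0
S₂ (suc n) zero    = 0
S₂ (suc n) (suc m) = suc m ℕ.* S₂ n (suc m) ℕ.+ S₂ n m

-- ι is meant to be a ring homomorphism; 1/ n ! then inverts n !.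
module BernoulliPolynomials {c ℓ} (R : CommutativeRing c ℓ) (ι : ℚ → CommutativeRing.Carrier R) where

  open CommutativeRing R hiding (zero)
  open import Algebra.Properties.Semiring.Exp semiring using (_^_)
  open import Algebra.Properties.Monoid.Sum +-monoid using (sum; sum-cong-≋)
  open import Relation.Binary.Reasoning.Setoid setoid

  fromℤ : ℤ → Carrier
  fromℤ i = ι (i ℚ./ 1)

  fromℕ : ℕ → Carrier
  fromℕ n = fromℤ (+ n)

  1/_! : ℕ → Carrier
  1/ n ! = ι ((+ 1 ℚ./ (n !)) {{n ℕₚ.!≢0}})

  falling : Carrier → ℕ → Carrier
  falling y zero    = 1#
  falling y (suc j) = falling y j * (y - fromℕ j)

  binom : Carrier → ℤ → Carrier
  binom y (+ j)    = falling y j * 1/ j !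
  binom y -[1+ j ] = 0#

  -- Empty when m > n, since then suc n ∸ m is 0.
  sumFromTo : ℕ → ℕ → (ℕ → Carrier) → Carrier
  sumFromTo m n f = sum {suc n ∸ m} λ i → f (m ℕ.+ toℕ i)

  syntax sumFromTo m n (λ l → e) = ∑[ m ≤ l ≤ n ] e

  -- f k is the coefficient of tᵏ.
  Series : Set c
  Series = ℕ → Carrier

  infixl 7 _⊛_
  infixr 8 _^ˢ_

  1ˢ : Series
  1ˢ zero    = 1#
  1ˢ (suc n) = 0#

  _⊛_ : Series → Series → Series
  (f ⊛ g) n = sum {suc n} λ i → f (toℕ i) * g (n ∸ toℕ i)

  _^ˢ_ : Series → ℕ → Series
  f ^ˢ zero  = 1ˢ
  f ^ˢ suc k = f ⊛ f ^ˢ k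

  -- For f with constant term 1, the coefficients gₙ , gₙ₋₁ , … , g₀ of g = 1 / f,
  -- from gₙ₊₁ = - Σ_{0 ≤ i ≤ n} fᵢ₊₁ gₙ₋ᵢ.
  inverseCoeffs : Series → ∀ n → Vector Carrier (suc n)
  inverseCoeffs f zero    = 1# Vector.∷ Vector.[]
  inverseCoeffs f (suc n) =
    (- sum λ i → f (suc (toℕ i)) * inverseCoeffs f n i) Vector.∷ inverseCoeffs f n

  inverse : Series → Series
  inverse f n = inverseCoeffs f n zero

  inverseCoeffs-inverse : ∀ f n i → inverseCoeffs f n i ≡ inverse f (n ∸ toℕ i)
  inverseCoeffs-inverse f n       zero    = ≡.refl
  inverseCoeffs-inverse f (suc n) (suc i) = inverseCoeffs-inverse f n i

  ⊛-inverse : ∀ f → f 0 ≈ 1# → ∀ n → (f ⊛ inverse f) n ≈ 1ˢ n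
  ⊛-inverse f f₀≈1 zero = begin
    f 0 * 1# + 0#  ≈⟨ +-identityʳ _ ⟩
    f 0 * 1#       ≈⟨ *-identityʳ _ ⟩
    f 0            ≈⟨ f₀≈1 ⟩
    1#             ∎
  ⊛-inverse f f₀≈1 (suc n) = begin
    f 0 * (- s) + sum {suc n} (λ i → f (suc (toℕ i)) * inverse f (n ∸ toℕ i))
      ≈⟨ +-cong (*-congʳ f₀≈1) (sum-cong-≋ {suc n} λ i →
           *-congˡ {f (suc (toℕ i))} (reflexive (≡.sym (inverseCoeffs-inverse f n i)))) ⟩
    1# * (- s) + s  ≈⟨ +-congʳ (*-identityˡ _) ⟩
    - s + s         ≈⟨ -‿inverseˡ s ⟩
    0#              ∎
    where
    s : Carrier
    s = sum λ i → f (suc (toℕ i)) * inverseCoeffs f n i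

  [eᵗ-1]/t : Series
  [eᵗ-1]/t k = 1/ suc k !

  t/[eᵗ-1] : Series
  t/[eᵗ-1] = inverse [eᵗ-1]/t

  t/[eᵗ-1]^_ : ℤ → Series
  t/[eᵗ-1]^ (+ k)    = t/[eᵗ-1] ^ˢ k
  t/[eᵗ-1]^ -[1+ k ] = [eᵗ-1]/t ^ˢ suc k

  -- e^(xt) as a series in t
  exp : Carrier → Series
  exp x k = x ^ k * 1/ k !

  -- Bₖ⁽ʳ⁾(x), from (t / (eᵗ - 1))ʳ e^(xt) = Σ Bₖ⁽ʳ⁾(x) tᵏ / k!
  B : ℕ → ℤ → Carrier → Carrier
  B k r x = fromℕ (k !) * (t/[eᵗ-1]^ r ⊛ exp x) k

-- With y = -an, m' = m - 1, N = n - m and E = (eᵗ - 1)/t, the factorials collapse and the l-th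
-- summand becomes (n-1)!/m'! · binom(y, k) · [t^(N-k)] E^(k+m') e^((1-y)t), where k = n - l.
-- The order l - m - n + 1 = -(k + m') is never positive, so E need not be inverted.
-- Since [t^(N-k)] Eᵏ g = [t^N] (eᵗ - 1)ᵏ g, the binomial series (1 + (eᵗ - 1))^y = e^(yt) sums
-- these to (n-1)!/m'! · [t^N] E^m' eᵗ = (n-1)!/m'! · [t^(n-1)] (eᵗ - 1)^m' eᵗ. As
-- (eᵗ - 1)^m' eᵗ = (eᵗ - 1)^m' + (eᵗ - 1)^m, this is S₂(n-1, m-1) + m S₂(n-1, m) = S₂(n, m).
-- The binomial series is read off coefficientwise from zⁱ = Σ S₂(i, k) (z)ₖ.
module Submission where

open import Defs
open import Algebra.Bundles using (CommutativeRing; CommutativeSemigroup)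
open import Data.Integer.Base as ℤ using (+_)
open import Data.Nat.Base using (ℕ; _∸_) renaming (_≤_ to _≤ℕ_)
open import Relation.Nullary.Negation using (¬_)
open import Algebra.Morphism.Structures using (IsRingHomomorphism)
open import Data.Fin.Base using (Fin; zero; suc; toℕ)
import Data.Fin.Properties as Finₚ
import Data.Integer.Properties as ℤₚ
import Data.Integer.Solver as ℤ-Solver
open import Data.Nat.Base as ℕ using (zero; suc; s≤s; _!)
import Data.Nat.Properties as ℕₚ
open import Data.Rational.Base as ℚ using (ℚ; 1ℚ)
import Data.Rational.Properties as ℚₚ
open import Data.Rational.Unnormalised.Base as ℚᵘ using (mkℚᵘ; *≡*)
import Data.Rational.Unnormalised.Properties as ℚᵘₚ
open import Data.Sum.Base using (inj₁; inj₂)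
open import Relation.Binary.PropositionalEquality as ≡ using (_≡_)

-- Natural numbers inside the rationals.

/1-homo-+ : ∀ m n → + (m ℕ.+ n) ℚ./ 1 ≡ (+ m ℚ./ 1) ℚ.+ (+ n ℚ./ 1)
-- `ℚ._/_` reduces to lowest terms and does not compute on variables, so this identity and the next
-- two are checked on unnormalised fractions and carried back by injectivity.
/1-homo-+ m n = ℚₚ.toℚᵘ-injective (begin
  ℚ.toℚᵘ (+ (m ℕ.+ n) ℚ./ 1)                    ≈⟨ ℚₚ.toℚᵘ-fromℚᵘ (mkℚᵘ (+ (m ℕ.+ n)) 0) ⟩
  mkℚᵘ (+ (m ℕ.+ n)) 0                          ≡⟨ ≡.cong (λ i → mkℚᵘ i 0) (≡.cong₂ ℤ._+_ (ℤₚ.*-identityʳ (+ m)) (ℤₚ.*-identityʳ (+ n))) ⟨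
  mkℚᵘ (+ m) 0 ℚᵘ.+ mkℚᵘ (+ n) 0                ≈⟨ ℚᵘₚ.+-cong (ℚₚ.toℚᵘ-fromℚᵘ (mkℚᵘ (+ m) 0)) (ℚₚ.toℚᵘ-fromℚᵘ (mkℚᵘ (+ n) 0)) ⟨
  ℚ.toℚᵘ (+ m ℚ./ 1) ℚᵘ.+ ℚ.toℚᵘ (+ n ℚ./ 1)    ≈⟨ ℚₚ.toℚᵘ-homo-+ (+ m ℚ./ 1) (+ n ℚ./ 1) ⟨
  ℚ.toℚᵘ ((+ m ℚ./ 1) ℚ.+ (+ n ℚ./ 1))          ∎)
  where open ℚᵘₚ.≃-Reasoning

/1-homo-* : ∀ m n → + (m ℕ.* n) ℚ./ 1 ≡ (+ m ℚ./ 1) ℚ.* (+ n ℚ./ 1)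
/1-homo-* m n = ℚₚ.toℚᵘ-injective (begin
  ℚ.toℚᵘ (+ (m ℕ.* n) ℚ./ 1)                    ≈⟨ ℚₚ.toℚᵘ-fromℚᵘ (mkℚᵘ (+ (m ℕ.* n)) 0) ⟩
  mkℚᵘ (+ (m ℕ.* n)) 0                          ≡⟨ ≡.cong (λ i → mkℚᵘ i 0) (ℤₚ.pos-* m n) ⟩
  mkℚᵘ (+ m) 0 ℚᵘ.* mkℚᵘ (+ n) 0                ≈⟨ ℚᵘₚ.*-cong (ℚₚ.toℚᵘ-fromℚᵘ (mkℚᵘ (+ m) 0)) (ℚₚ.toℚᵘ-fromℚᵘ (mkℚᵘ (+ n) 0)) ⟨
  ℚ.toℚᵘ (+ m ℚ./ 1) ℚᵘ.* ℚ.toℚᵘ (+ n ℚ./ 1)    ≈⟨ ℚₚ.toℚᵘ-homo-* (+ m ℚ./ 1) (+ n ℚ./ 1) ⟨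
  ℚ.toℚᵘ ((+ m ℚ./ 1) ℚ.* (+ n ℚ./ 1))          ∎)
  where open ℚᵘₚ.≃-Reasoning

n*1/n≡1 : ∀ n .{{_ : ℕ.NonZero n}} → (+ n ℚ./ 1) ℚ.* (+ 1 ℚ./ n) ≡ 1ℚ
n*1/n≡1 n@(suc n-1) = ℚₚ.toℚᵘ-injective (begin
  ℚ.toℚᵘ ((+ n ℚ./ 1) ℚ.* (+ 1 ℚ./ n))          ≈⟨ ℚₚ.toℚᵘ-homo-* (+ n ℚ./ 1) (+ 1 ℚ./ n) ⟩
  ℚ.toℚᵘ (+ n ℚ./ 1) ℚᵘ.* ℚ.toℚᵘ (+ 1 ℚ./ n)    ≈⟨ ℚᵘₚ.*-cong (ℚₚ.toℚᵘ-fromℚᵘ (mkℚᵘ (+ n) 0)) (ℚₚ.toℚᵘ-fromℚᵘ (mkℚᵘ (+ 1) n-1)) ⟩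
  mkℚᵘ (+ n) 0 ℚᵘ.* mkℚᵘ (+ 1) n-1              ≈⟨ *≡* (≡.cong +_ (≡.trans (ℕₚ.*-identityʳ (n ℕ.* 1)) (≡.trans (ℕₚ.*-comm n 1) (≡.sym (ℕₚ.*-identityˡ (1 ℕ.* n)))))) ⟩
  ℚ.toℚᵘ 1ℚ                                     ∎)
  where open ℚᵘₚ.≃-Reasoning

S₂-zero : ∀ {n m} → n ℕ.< m → S₂ n m ≡ 0
S₂-zero {zero}  {suc m} _         = ≡.refl
S₂-zero {suc n} {suc m} (s≤s n<m)
  rewrite S₂-zero (ℕₚ.m<n⇒m<1+n n<m) | S₂-zero n<m = ≡.trans (ℕₚ.+-identityʳ (m ℕ.* 0)) (ℕₚ.*-zeroʳ m)

-- The order l - m - n + 1 of a summand, in the coordinates used by `summand-k+j`.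
order≡ : ∀ m k j →
  + suc (m ℕ.+ j) ℤ.- + suc m ℤ.- + suc (m ℕ.+ (k ℕ.+ j)) ℤ.+ + 1 ≡ ℤ.- + (k ℕ.+ m)
order≡ m k j = solve 3 (λ m k j →
    (con (+ 1) :+ m :+ j) :- (con (+ 1) :+ m) :- (con (+ 1) :+ (m :+ (k :+ j))) :+ con (+ 1)
      := :- (k :+ m))
  ≡.refl (+ m) (+ k) (+ j)
  where open ℤ-Solver.+-*-Solver

-- The argument uses only ring identities and inverses of factorials. Working over any commutative
-- ring with a ring homomorphism from ℚ keeps the Cauchy sequences behind ℂ out of the computation.
module StirlingBernoulli {c ℓ} (R : CommutativeRing c ℓ) (ι : ℚ → CommutativeRing.Carrier R)
  (ι-hom : IsRingHomomorphism ℚ.+-*-rawRing (CommutativeRing.rawRing R) ι) where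

  open CommutativeRing R hiding (zero)
  open BernoulliPolynomials R ι
  open import Algebra.Properties.Monoid.Sum +-monoid
    using (sum; sum-cong-≋; sum-replicate-zero)
  open import Algebra.Properties.CommutativeMonoid.Sum +-commutativeMonoid using (∑-distrib-+; ∑-comm)
  open import Algebra.Properties.Semiring.Sum semiring using (*-distribˡ-sum; *-distribʳ-sum)
  open import Algebra.Properties.Semiring.Exp semiring using (_^_; ^-congˡ)
  open import Algebra.Properties.CommutativeSemigroup *-commutativeSemigroup
    using (x∙yz≈y∙xz; xy∙z≈xz∙y)
  open import Algebra.Solver.Ring.NaturalCoefficients.Default commutativeSemiring
    using (solve; _:=_; _:+_; _:*_)
  open import Relation.Binary.Reasoning.Setoid setoid

  private
    module ι = IsRingHomomorphism ι-hom

    infix 4 _≋_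

    _≋_ : Series → Series → Set ℓ
    f ≋ g = ∀ n → f n ≈ g n

  -- Natural numbers and reciprocal factorials in the ring.

  fromℕ-+ : ∀ m n → fromℕ (m ℕ.+ n) ≈ fromℕ m + fromℕ n
  fromℕ-+ m n = trans (ι.⟦⟧-cong (/1-homo-+ m n)) (ι.+-homo _ _)

  fromℕ-* : ∀ m n → fromℕ (m ℕ.* n) ≈ fromℕ m * fromℕ n
  fromℕ-* m n = trans (ι.⟦⟧-cong (/1-homo-* m n)) (ι.*-homo _ _)

  fromℕ-0 : fromℕ 0 ≈ 0#
  fromℕ-0 = ι.0#-homo

  fromℕ-1 : fromℕ 1 ≈ 1#
  fromℕ-1 = ι.1#-homo

  fromℕ-cong : ∀ {m n} → m ≡ n → fromℕ m ≈ fromℕ n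
  fromℕ-cong ≡.refl = refl

  n!*1/n! : ∀ n → fromℕ (n !) * 1/ n ! ≈ 1#
  n!*1/n! n = trans (sym (ι.*-homo _ _))
    (trans (ι.⟦⟧-cong (n*1/n≡1 (n !) {{n ℕₚ.!≢0}})) ι.1#-homo)

  1/0! : 1/ 0 ! ≈ 1#
  1/0! = ι.1#-homo

  suc*1/suc! : ∀ n → fromℕ (suc n) * 1/ suc n ! ≈ 1/ n !
  suc*1/suc! n = begin
    fromℕ (suc n) * 1/ suc n !                               ≈⟨ *-identityʳ _ ⟨
    fromℕ (suc n) * 1/ suc n ! * 1#                          ≈⟨ *-congˡ (n!*1/n! n) ⟨
    fromℕ (suc n) * 1/ suc n ! * (fromℕ (n !) * 1/ n !)      ≈⟨ shuffle _ _ _ _ ⟩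
    fromℕ (suc n) * fromℕ (n !) * 1/ suc n ! * 1/ n !        ≈⟨ *-congʳ (*-congʳ (fromℕ-* (suc n) (n !))) ⟨
    fromℕ (suc n !) * 1/ suc n ! * 1/ n !                    ≈⟨ *-congʳ (n!*1/n! (suc n)) ⟩
    1# * 1/ n !                                              ≈⟨ *-identityˡ _ ⟩
    1/ n !                                                   ∎
    where
    shuffle = solve 4 (λ a b c d → a :* b :* (c :* d) := a :* c :* b :* d) refl

  -- The product n! · 1/(n+1)! serves as the inverse of n + 1.
  suc-cancel : ∀ n {x y} → fromℕ (suc n) * x ≈ fromℕ (suc n) * y → x ≈ y
  suc-cancel n {x} {y} eq = begin
    x                                               ≈⟨ expand x ⟩
    fromℕ (n !) * 1/ suc n ! * (fromℕ (suc n) * x)  ≈⟨ *-congˡ eq ⟩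
    fromℕ (n !) * 1/ suc n ! * (fromℕ (suc n) * y)  ≈⟨ expand y ⟨
    y                                               ∎
    where
    shuffle = solve 4 (λ a b c z → a :* (c :* b) :* z := a :* b :* (c :* z)) refl
    expand : ∀ z → z ≈ fromℕ (n !) * 1/ suc n ! * (fromℕ (suc n) * z)
    expand z = begin
      z                                               ≈⟨ *-identityˡ z ⟨
      1# * z                                          ≈⟨ *-congʳ (n!*1/n! n) ⟨
      fromℕ (n !) * 1/ n ! * z                        ≈⟨ *-congʳ (*-congˡ (suc*1/suc! n)) ⟨
      fromℕ (n !) * (fromℕ (suc n) * 1/ suc n !) * z  ≈⟨ shuffle _ _ _ _ ⟩
      fromℕ (n !) * 1/ suc n ! * (fromℕ (suc n) * z)  ∎

  -- Formal power series under convolution.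

  infixr 7 _·_
  infixl 6 _+ˢ_

  _+ˢ_ : Series → Series → Series
  (f +ˢ g) n = f n + g n

  _·_ : Carrier → Series → Series
  (x · f) n = x * f n

  tail : Series → Series
  tail f n = f (suc n)

  -- Multiplication by t; `tail` is its left inverse.
  shift : Series → Series
  shift f zero    = 0#
  shift f (suc n) = f n

  -- The formal derivative d/dt.
  D : Series → Series
  D f n = fromℕ (suc n) * f (suc n)

  ⊛-cong : ∀ {f f′ g g′} → f ≋ f′ → g ≋ g′ → f ⊛ g ≋ f′ ⊛ g′
  ⊛-cong f≋f′ g≋g′ n = sum-cong-≋ {suc n} λ i → *-cong (f≋f′ (toℕ i)) (g≋g′ (n ∸ toℕ i))

  ⊛-congˡ : ∀ f {g g′} → g ≋ g′ → f ⊛ g ≋ f ⊛ g′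
  ⊛-congˡ f = ⊛-cong {f} (λ _ → refl)

  ⊛-congʳ : ∀ {f f′} g → f ≋ f′ → f ⊛ g ≋ f′ ⊛ g
  ⊛-congʳ g f≋f′ = ⊛-cong {g = g} f≋f′ (λ _ → refl)

  ⊛-distribʳ-+ : ∀ h f g → (f +ˢ g) ⊛ h ≋ f ⊛ h +ˢ g ⊛ h
  ⊛-distribʳ-+ h f g n = trans
    (sum-cong-≋ {suc n} λ i → distribʳ (h (n ∸ toℕ i)) (f (toℕ i)) (g (toℕ i)))
    (∑-distrib-+ {suc n} (λ i → f (toℕ i) * h (n ∸ toℕ i)) (λ i → g (toℕ i) * h (n ∸ toℕ i)))

  ·-⊛-assoc : ∀ x f g → (x · f) ⊛ g ≋ x · (f ⊛ g)
  ·-⊛-assoc x f g n = trans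
    (sum-cong-≋ {suc n} λ i → *-assoc x (f (toℕ i)) (g (n ∸ toℕ i)))
    (sym (*-distribˡ-sum {suc n} x (λ i → f (toℕ i) * g (n ∸ toℕ i))))

  -- By definition the sum splits off its first term, f 0 * g (suc n). Splitting off the last one
  -- instead is what lets commutativity go by induction.
  ⊛-suc : ∀ f g n → (f ⊛ g) (suc n) ≈ (f ⊛ tail g) n + f (suc n) * g 0
  ⊛-suc f g zero    = solve 3 (λ x y z → x :+ (y :+ z) := (x :+ z) :+ y) refl _ _ _
  ⊛-suc f g (suc n) = trans (+-congˡ (⊛-suc (tail f) g n)) (sym (+-assoc _ _ _))

  ⊛-comm : ∀ f g → f ⊛ g ≋ g ⊛ f
  ⊛-comm f g zero    = +-congʳ (*-comm (f 0) (g 0))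
  ⊛-comm f g (suc n) = begin
    f 0 * g (suc n) + (tail f ⊛ g) n  ≈⟨ +-cong (*-comm _ _) (⊛-comm (tail f) g n) ⟩
    g (suc n) * f 0 + (g ⊛ tail f) n  ≈⟨ +-comm _ _ ⟩
    (g ⊛ tail f) n + g (suc n) * f 0  ≈⟨ ⊛-suc g f n ⟨
    (g ⊛ f) (suc n)                   ∎

  ⊛-assoc : ∀ f g h → (f ⊛ g) ⊛ h ≋ f ⊛ (g ⊛ h)
  ⊛-assoc f g h zero = +-congʳ (begin
    (f 0 * g 0 + 0#) * h 0  ≈⟨ *-congʳ (+-identityʳ _) ⟩
    f 0 * g 0 * h 0         ≈⟨ *-assoc _ _ _ ⟩
    f 0 * (g 0 * h 0)       ≈⟨ *-congˡ (+-identityʳ _) ⟨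
    f 0 * (g 0 * h 0 + 0#)  ∎)
  ⊛-assoc f g h (suc n) = begin
    -- The tail of `f ⊛ g` unfolds to `f 0 · tail g +ˢ tail f ⊛ g`, which reduces the claim to the
    -- one for `tail f`.
    (f 0 * g 0 + 0#) * h (suc n) + ((f 0 · tail g +ˢ tail f ⊛ g) ⊛ h) n
      ≈⟨ +-cong (*-congʳ (+-identityʳ _)) (⊛-distribʳ-+ h (f 0 · tail g) (tail f ⊛ g) n) ⟩
    f 0 * g 0 * h (suc n) + (((f 0 · tail g) ⊛ h) n + ((tail f ⊛ g) ⊛ h) n)
      ≈⟨ +-congˡ (+-cong (·-⊛-assoc (f 0) (tail g) h n) (⊛-assoc (tail f) g h n)) ⟩
    f 0 * g 0 * h (suc n) + (f 0 * (tail g ⊛ h) n + (tail f ⊛ (g ⊛ h)) n)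
      ≈⟨ solve 5 (λ x y z v w → x :* y :* z :+ (x :* v :+ w) := x :* (y :* z :+ v) :+ w) refl _ _ _ _ _ ⟩
    f 0 * (g ⊛ h) (suc n) + (tail f ⊛ (g ⊛ h)) n
      ∎

  ⊛-zeroˡ : ∀ {f} g → f ≋ (λ _ → 0#) → ∀ n → (f ⊛ g) n ≈ 0#
  ⊛-zeroˡ g f≋0 n = trans
    (sum-cong-≋ {suc n} λ i → trans (*-congʳ (f≋0 (toℕ i))) (zeroˡ (g (n ∸ toℕ i))))
    (sum-replicate-zero (suc n))

  ⊛-identityˡ : ∀ f → 1ˢ ⊛ f ≋ f
  ⊛-identityˡ f zero    = trans (+-identityʳ _) (*-identityˡ _)
  ⊛-identityˡ f (suc n) =
    trans (+-cong (*-identityˡ _) (⊛-zeroˡ f (λ _ → refl) n)) (+-identityʳ _)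

  ⊛-commutativeSemigroup : CommutativeSemigroup c ℓ
  ⊛-commutativeSemigroup = record
    { Carrier = Series
    ; _≈_     = _≋_
    ; _∙_     = _⊛_
    ; isCommutativeSemigroup = record
      { isSemigroup = record
        { isMagma = record
          { isEquivalence = record
            { refl  = λ _ → refl
            ; sym   = λ p n → sym (p n)
            ; trans = λ p q n → trans (p n) (q n)
            }
          ; ∙-cong = ⊛-cong
          }
        ; assoc = ⊛-assoc
        }
      ; comm = ⊛-comm
      }
    }

  open import Algebra.Properties.CommutativeSemigroup ⊛-commutativeSemigroup
    using () renaming (x∙yz≈y∙xz to f⊛gh≋g⊛fh)

  -- Powers of series and of their multiples by t.

  ^ˢ-+ : ∀ f j k → f ^ˢ (j ℕ.+ k) ≋ f ^ˢ j ⊛ f ^ˢ k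
  ^ˢ-+ f zero    k n = sym (⊛-identityˡ (f ^ˢ k) n)
  ^ˢ-+ f (suc j) k n =
    trans (⊛-congˡ f (^ˢ-+ f j k) n) (sym (⊛-assoc f (f ^ˢ j) (f ^ˢ k) n))

  shift-⊛ : ∀ f g n → (shift f ⊛ g) (suc n) ≈ (f ⊛ g) n
  shift-⊛ f g n = trans (+-congʳ (zeroˡ (g (suc n)))) (+-identityˡ _)

  -- This is (t f)ᵏ g = tᵏ fᵏ g, the passage between the powers of (eᵗ - 1)/t and those of eᵗ - 1.
  -- The factor g is kept general because each induction step absorbs one f into it.
  shift-^ˢ-⊛ : ∀ f k g n → (shift f ^ˢ k ⊛ g) (k ℕ.+ n) ≈ (f ^ˢ k ⊛ g) n
  shift-^ˢ-⊛ f zero    g n = refl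
  shift-^ˢ-⊛ f (suc k) g n = begin
    ((shift f ⊛ shift f ^ˢ k) ⊛ g) (suc (k ℕ.+ n))  ≈⟨ ⊛-assoc (shift f) (shift f ^ˢ k) g (suc (k ℕ.+ n)) ⟩
    (shift f ⊛ (shift f ^ˢ k ⊛ g)) (suc (k ℕ.+ n))  ≈⟨ shift-⊛ f (shift f ^ˢ k ⊛ g) (k ℕ.+ n) ⟩
    (f ⊛ (shift f ^ˢ k ⊛ g)) (k ℕ.+ n)              ≈⟨ f⊛gh≋g⊛fh f (shift f ^ˢ k) g (k ℕ.+ n) ⟩
    (shift f ^ˢ k ⊛ (f ⊛ g)) (k ℕ.+ n)              ≈⟨ shift-^ˢ-⊛ f k (f ⊛ g) n ⟩
    (f ^ˢ k ⊛ (f ⊛ g)) n                            ≈⟨ f⊛gh≋g⊛fh (f ^ˢ k) f g n ⟩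
    (f ⊛ (f ^ˢ k ⊛ g)) n                            ≈⟨ ⊛-assoc f (f ^ˢ k) g n ⟨
    (f ^ˢ suc k ⊛ g) n                              ∎

  -- The formal derivative of products and powers.

  -- Leibniz is immediate for t d/dt, which multiplies the n-th coefficient by n; D is its tail.
  D-⊛ : ∀ f g → D (f ⊛ g) ≋ D f ⊛ g +ˢ f ⊛ D g
  D-⊛ f g n = begin
    θ (f ⊛ g) (suc n)                         ≈⟨ θ-⊛ (suc n) ⟩
    (θ f ⊛ g) (suc n) + (f ⊛ θ g) (suc n)     ≈⟨ +-cong θf⊛g (trans (⊛-suc f (θ g) n) f⊛θg) ⟩
    (D f ⊛ g) n + (f ⊛ D g) n                 ∎
    where
    θ : Series → Series
    θ h k = fromℕ k * h k

    θ₀≈0 : ∀ h → θ h 0 ≈ 0#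
    θ₀≈0 h = trans (*-congʳ fromℕ-0) (zeroˡ (h 0))

    θf⊛g : (θ f ⊛ g) (suc n) ≈ (D f ⊛ g) n
    θf⊛g = trans (+-congʳ (trans (*-congʳ (θ₀≈0 f)) (zeroˡ _))) (+-identityˡ _)

    f⊛θg : (f ⊛ D g) n + f (suc n) * θ g 0 ≈ (f ⊛ D g) n
    f⊛θg = trans (+-congˡ (trans (*-congˡ (θ₀≈0 g)) (zeroʳ _))) (+-identityʳ _)

    θ-⊛ : ∀ k → θ (f ⊛ g) k ≈ (θ f ⊛ g) k + (f ⊛ θ g) k
    θ-⊛ k = begin
      fromℕ k * (f ⊛ g) k
        ≈⟨ *-distribˡ-sum {suc k} (fromℕ k) (λ i → f (toℕ i) * g (k ∸ toℕ i)) ⟩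
      sum {suc k} (λ i → fromℕ k * (f (toℕ i) * g (k ∸ toℕ i)))
        ≈⟨ sum-cong-≋ {suc k} (λ i → trans (*-congʳ (split i))
             (solve 4 (λ i j x y → (i :+ j) :* (x :* y) := i :* x :* y :+ x :* (j :* y))
               refl _ _ (f (toℕ i)) (g (k ∸ toℕ i)))) ⟩
      sum {suc k} (λ i → fromℕ (toℕ i) * f (toℕ i) * g (k ∸ toℕ i)
                       + f (toℕ i) * (fromℕ (k ∸ toℕ i) * g (k ∸ toℕ i)))
        ≈⟨ ∑-distrib-+ {suc k} (λ i → θ f (toℕ i) * g (k ∸ toℕ i)) (λ i → f (toℕ i) * θ g (k ∸ toℕ i)) ⟩
      (θ f ⊛ g) k + (f ⊛ θ g) k
        ∎
      where
      split : ∀ (i : Fin (suc k)) → fromℕ k ≈ fromℕ (toℕ i) + fromℕ (k ∸ toℕ i)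
      split i = trans (fromℕ-cong (≡.sym (ℕₚ.m+[n∸m]≡n (Finₚ.toℕ≤pred[n] i)))) (fromℕ-+ (toℕ i) (k ∸ toℕ i))

  D-^ˢ : ∀ f k → D (f ^ˢ suc k) ≋ fromℕ (suc k) · (f ^ˢ k ⊛ D f)
  D-^ˢ f k n = begin
    D (f ⊛ f ^ˢ k) n                                      ≈⟨ D-⊛ f (f ^ˢ k) n ⟩
    (D f ⊛ f ^ˢ k) n + (f ⊛ D (f ^ˢ k)) n                 ≈⟨ +-cong (⊛-comm (D f) (f ^ˢ k) n) (f⊛D k) ⟩
    (f ^ˢ k ⊛ D f) n + fromℕ k * (f ^ˢ k ⊛ D f) n         ≈⟨ +-congʳ (*-identityˡ _) ⟨
    1# * (f ^ˢ k ⊛ D f) n + fromℕ k * (f ^ˢ k ⊛ D f) n    ≈⟨ distribʳ _ _ _ ⟨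
    (1# + fromℕ k) * (f ^ˢ k ⊛ D f) n                     ≈⟨ *-congʳ (trans (+-congʳ (sym fromℕ-1)) (sym (fromℕ-+ 1 k))) ⟩
    fromℕ (suc k) * (f ^ˢ k ⊛ D f) n                      ∎
    where
    -- The Leibniz rule leaves f · D(fᵏ). Keeping the extra factor f avoids the exponent k - 1, so
    -- that k = 0 fits the same formula.
    f⊛D : ∀ k → (f ⊛ D (f ^ˢ k)) n ≈ fromℕ k * (f ^ˢ k ⊛ D f) n
    f⊛D zero = begin
      (f ⊛ D 1ˢ) n                  ≈⟨ ⊛-comm f (D 1ˢ) n ⟩
      (D 1ˢ ⊛ f) n                  ≈⟨ ⊛-zeroˡ f (λ i → zeroʳ (fromℕ (suc i))) n ⟩
      0#                            ≈⟨ zeroˡ _ ⟨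
      0# * (1ˢ ⊛ D f) n             ≈⟨ *-congʳ fromℕ-0 ⟨
      fromℕ 0 * (1ˢ ⊛ D f) n        ∎
    f⊛D (suc k) = begin
      (f ⊛ D (f ^ˢ suc k)) n                        ≈⟨ ⊛-congˡ f (D-^ˢ f k) n ⟩
      (f ⊛ (fromℕ (suc k) · (f ^ˢ k ⊛ D f))) n        ≈⟨ ⊛-comm f (fromℕ (suc k) · (f ^ˢ k ⊛ D f)) n ⟩
      ((fromℕ (suc k) · (f ^ˢ k ⊛ D f)) ⊛ f) n      ≈⟨ ·-⊛-assoc (fromℕ (suc k)) (f ^ˢ k ⊛ D f) f n ⟩
      fromℕ (suc k) * ((f ^ˢ k ⊛ D f) ⊛ f) n        ≈⟨ *-congˡ (⊛-comm (f ^ˢ k ⊛ D f) f n) ⟩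
      fromℕ (suc k) * (f ⊛ (f ^ˢ k ⊛ D f)) n        ≈⟨ *-congˡ (⊛-assoc f (f ^ˢ k) (D f) n) ⟨
      fromℕ (suc k) * (f ^ˢ suc k ⊛ D f) n          ∎

  -- The exponential series.

  D-exp : ∀ x → D (exp x) ≋ x · exp x
  D-exp x n = begin
    fromℕ (suc n) * (x * x ^ n * 1/ suc n !)    ≈⟨ solve 4 (λ s x p q → s :* (x :* p :* q) := x :* (p :* (s :* q))) refl _ _ _ _ ⟩
    x * (x ^ n * (fromℕ (suc n) * 1/ suc n !))  ≈⟨ *-congˡ (*-congˡ (suc*1/suc! n)) ⟩
    x * (x ^ n * 1/ n !)                        ∎

  exp₀≈1 : ∀ x → exp x 0 ≈ 1#
  exp₀≈1 x = trans (*-identityˡ _) 1/0!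

  -- The differential equation is the recurrence (n + 1) fₙ₊₁ = x fₙ, which determines f from its
  -- constant term because n + 1 can be cancelled.
  exp-unique : ∀ f x → D f ≋ x · f → f ≋ f 0 · exp x
  exp-unique f x Df≋xf zero    = sym (trans (*-congˡ (exp₀≈1 x)) (*-identityʳ (f 0)))
  exp-unique f x Df≋xf (suc n) = suc-cancel n (begin
    fromℕ (suc n) * f (suc n)              ≈⟨ Df≋xf n ⟩
    x * f n                                ≈⟨ *-congˡ (exp-unique f x Df≋xf n) ⟩
    x * (f 0 * exp x n)                    ≈⟨ x∙yz≈y∙xz x (f 0) _ ⟩
    f 0 * (x * exp x n)                    ≈⟨ *-congˡ (D-exp x n) ⟨
    f 0 * (fromℕ (suc n) * exp x (suc n))  ≈⟨ x∙yz≈y∙xz (f 0) (fromℕ (suc n)) _ ⟩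
    fromℕ (suc n) * (f 0 * exp x (suc n))  ∎)

  -- Both sides solve D f = (x + y) f and have constant term 1.
  exp-+ : ∀ x y → exp x ⊛ exp y ≋ exp (x + y)
  exp-+ x y n = begin
    (exp x ⊛ exp y) n                      ≈⟨ exp-unique (exp x ⊛ exp y) (x + y) derivative n ⟩
    (exp x ⊛ exp y) 0 * exp (x + y) n      ≈⟨ *-congʳ (trans (+-identityʳ _) (trans (*-cong (exp₀≈1 x) (exp₀≈1 y)) (*-identityˡ 1#))) ⟩
    1# * exp (x + y) n                     ≈⟨ *-identityˡ _ ⟩
    exp (x + y) n                          ∎
    where
    derivative : D (exp x ⊛ exp y) ≋ (x + y) · (exp x ⊛ exp y)
    derivative k = begin
      D (exp x ⊛ exp y) k
        ≈⟨ D-⊛ (exp x) (exp y) k ⟩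
      (D (exp x) ⊛ exp y) k + (exp x ⊛ D (exp y)) k
        ≈⟨ +-cong (trans (⊛-congʳ (exp y) (D-exp x) k) (·-⊛-assoc x (exp x) (exp y) k))
             (trans (⊛-comm (exp x) (D (exp y)) k)
               (trans (⊛-congʳ (exp x) (D-exp y) k)
                 (trans (·-⊛-assoc y (exp y) (exp x) k) (*-congˡ (⊛-comm (exp y) (exp x) k))))) ⟩
      x * (exp x ⊛ exp y) k + y * (exp x ⊛ exp y) k
        ≈⟨ distribʳ _ x y ⟨
      (x + y) * (exp x ⊛ exp y) k
        ∎

  -- Powers of eᵗ - 1 as generating functions of the Stirling numbers.

  eᵗ-1 : Series
  eᵗ-1 = shift [eᵗ-1]/t

  -- Justifies the name of `eᵗ-1`, which is defined as t times `[eᵗ-1]/t`.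
  exp-1 : exp 1# ≋ 1ˢ +ˢ eᵗ-1
  exp-1 zero    = trans (exp₀≈1 1#) (sym (+-identityʳ 1#))
  exp-1 (suc n) = trans (*-congʳ (1^n≈1 (suc n))) (trans (*-identityˡ _) (sym (+-identityˡ _)))
    where
    1^n≈1 : ∀ n → 1# ^ n ≈ 1#
    1^n≈1 zero    = refl
    1^n≈1 (suc n) = trans (*-identityˡ _) (1^n≈1 n)

  D-eᵗ-1 : D eᵗ-1 ≋ exp 1#
  D-eᵗ-1 zero    = trans (suc*1/suc! 0) (trans 1/0! (sym (exp₀≈1 1#)))
  D-eᵗ-1 (suc n) = trans (suc*1/suc! (suc n)) (sym (trans (exp-1 (suc n)) (+-identityˡ _)))

  ⊛-exp-1 : ∀ k n → (eᵗ-1 ^ˢ k ⊛ exp 1#) n ≈ (eᵗ-1 ^ˢ k) n + (eᵗ-1 ^ˢ suc k) n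
  ⊛-exp-1 k n = begin
    (eᵗ-1 ^ˢ k ⊛ exp 1#) n                       ≈⟨ ⊛-comm (eᵗ-1 ^ˢ k) (exp 1#) n ⟩
    (exp 1# ⊛ eᵗ-1 ^ˢ k) n                       ≈⟨ ⊛-congʳ (eᵗ-1 ^ˢ k) exp-1 n ⟩
    ((1ˢ +ˢ eᵗ-1) ⊛ eᵗ-1 ^ˢ k) n                 ≈⟨ ⊛-distribʳ-+ (eᵗ-1 ^ˢ k) 1ˢ eᵗ-1 n ⟩
    (1ˢ ⊛ eᵗ-1 ^ˢ k) n + (eᵗ-1 ^ˢ suc k) n       ≈⟨ +-congʳ (⊛-identityˡ (eᵗ-1 ^ˢ k) n) ⟩
    (eᵗ-1 ^ˢ k) n + (eᵗ-1 ^ˢ suc k) n            ∎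

  -- The exponential generating function of S₂(n, k) in n is uᵏ/k! with u = eᵗ - 1. Induction on n:
  -- D(uᵏ⁺¹) = (k + 1) uᵏ eᵗ, and uᵏ eᵗ = uᵏ + uᵏ⁺¹ mirrors the recurrence of S₂. The two statements
  -- are mutually recursive, the one with the factor eᵗ being the shifted form that the final sum
  -- needs.
  n![eᵗ-1]^ : ∀ n k → fromℕ (n !) * (eᵗ-1 ^ˢ k) n ≈ fromℕ (k !) * fromℕ (S₂ n k)

  n![eᵗ-1]^⊛eᵗ : ∀ n k →
    fromℕ (n !) * (eᵗ-1 ^ˢ k ⊛ exp 1#) n ≈ fromℕ (k !) * fromℕ (S₂ (suc n) (suc k))
  n![eᵗ-1]^⊛eᵗ n k = begin
    fromℕ (n !) * (eᵗ-1 ^ˢ k ⊛ exp 1#) n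
      ≈⟨ *-congˡ (⊛-exp-1 k n) ⟩
    fromℕ (n !) * ((eᵗ-1 ^ˢ k) n + (eᵗ-1 ^ˢ suc k) n)
      ≈⟨ distribˡ _ _ _ ⟩
    fromℕ (n !) * (eᵗ-1 ^ˢ k) n + fromℕ (n !) * (eᵗ-1 ^ˢ suc k) n
      ≈⟨ +-cong (n![eᵗ-1]^ n k) (trans (n![eᵗ-1]^ n (suc k)) (*-congʳ (fromℕ-* (suc k) (k !)))) ⟩
    fromℕ (k !) * fromℕ (S₂ n k) + fromℕ (suc k) * fromℕ (k !) * fromℕ (S₂ n (suc k))
      ≈⟨ solve 4 (λ a x b y → a :* x :+ b :* a :* y := a :* (b :* y :+ x)) refl _ _ _ _ ⟩
    fromℕ (k !) * (fromℕ (suc k) * fromℕ (S₂ n (suc k)) + fromℕ (S₂ n k))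
      ≈⟨ *-congˡ (+-congʳ (fromℕ-* (suc k) (S₂ n (suc k)))) ⟨
    fromℕ (k !) * (fromℕ (suc k ℕ.* S₂ n (suc k)) + fromℕ (S₂ n k))
      ≈⟨ *-congˡ (fromℕ-+ (suc k ℕ.* S₂ n (suc k)) (S₂ n k)) ⟨
    fromℕ (k !) * fromℕ (S₂ (suc n) (suc k))
      ∎

  n![eᵗ-1]^ zero    zero    = *-congˡ (sym fromℕ-1)
  n![eᵗ-1]^ zero    (suc k) = trans (trans (*-congˡ (trans (+-identityʳ _) (zeroˡ _))) (zeroʳ _))
    (sym (trans (*-congˡ fromℕ-0) (zeroʳ _)))
  n![eᵗ-1]^ (suc n) zero    = trans (zeroʳ _) (sym (trans (*-congˡ fromℕ-0) (zeroʳ _)))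
  n![eᵗ-1]^ (suc n) (suc k) = begin
    fromℕ (suc n !) * (eᵗ-1 ^ˢ suc k) (suc n)
      ≈⟨ *-congʳ (trans (fromℕ-* (suc n) (n !)) (*-comm _ _)) ⟩
    fromℕ (n !) * fromℕ (suc n) * (eᵗ-1 ^ˢ suc k) (suc n)
      ≈⟨ *-assoc _ _ _ ⟩
    fromℕ (n !) * D (eᵗ-1 ^ˢ suc k) n
      ≈⟨ *-congˡ (trans (D-^ˢ eᵗ-1 k n) (*-congˡ (⊛-congˡ (eᵗ-1 ^ˢ k) D-eᵗ-1 n))) ⟩
    fromℕ (n !) * (fromℕ (suc k) * (eᵗ-1 ^ˢ k ⊛ exp 1#) n)
      ≈⟨ x∙yz≈y∙xz _ _ _ ⟩
    fromℕ (suc k) * (fromℕ (n !) * (eᵗ-1 ^ˢ k ⊛ exp 1#) n)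
      ≈⟨ *-congˡ (n![eᵗ-1]^⊛eᵗ n k) ⟩
    fromℕ (suc k) * (fromℕ (k !) * fromℕ (S₂ (suc n) (suc k)))
      ≈⟨ *-assoc _ _ _ ⟨
    fromℕ (suc k) * fromℕ (k !) * fromℕ (S₂ (suc n) (suc k))
      ≈⟨ *-congʳ (fromℕ-* (suc k) (k !)) ⟨
    fromℕ (suc k !) * fromℕ (S₂ (suc n) (suc k))
      ∎

  -- Finite sums and falling factorials.

  sum-snoc : ∀ n (f : ℕ → Carrier) → sum {suc n} (λ i → f (toℕ i)) ≈ sum {n} (λ i → f (toℕ i)) + f n
  sum-snoc zero    f = +-comm _ _
  sum-snoc (suc n) f = trans (+-congˡ (sum-snoc n (λ i → f (suc i)))) (sym (+-assoc _ _ _))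

  sum-reverse : ∀ n (f : ℕ → Carrier) →
    sum {suc n} (λ i → f (n ∸ toℕ i)) ≈ sum {suc n} (λ i → f (toℕ i))
  sum-reverse zero    f = refl
  sum-reverse (suc n) f =
    trans (+-congˡ (sum-reverse n f)) (trans (+-comm _ _) (sym (sum-snoc (suc n) f)))

  falling-cong : ∀ {x y} → x ≈ y → ∀ k → falling x k ≈ falling y k
  falling-cong x≈y zero    = refl
  falling-cong x≈y (suc k) = *-cong (falling-cong x≈y k) (+-congʳ x≈y)

  x+y-x≈y : ∀ x y → x + y - x ≈ y
  x+y-x≈y x y = begin
    x + y - x    ≈⟨ +-congʳ (+-comm x y) ⟩
    y + x - x    ≈⟨ +-assoc y x (- x) ⟩
    y + (x - x)  ≈⟨ +-congˡ (-‿inverseʳ x) ⟩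
    y + 0#       ≈⟨ +-identityʳ y ⟩
    y            ∎

  -- In the step, the last factor (k + 1 + n) - k is n + 1 and turns n! into (n + 1)!, so the
  -- induction continues with n + 1. Used twice, this collapses the factorials of a summand.
  falling-! : ∀ k n → falling (fromℕ (k ℕ.+ n)) k * fromℕ (n !) ≈ fromℕ ((k ℕ.+ n) !)
  falling-! zero    n = *-identityˡ _
  falling-! (suc k) n = begin
    falling x k * (x - fromℕ k) * fromℕ (n !)
      ≈⟨ *-congʳ (*-cong (falling-cong (fromℕ-cong shift-suc) k)
           (trans (+-congʳ (trans (fromℕ-cong shift-suc) (fromℕ-+ k (suc n)))) (x+y-x≈y (fromℕ k) (fromℕ (suc n))))) ⟩
    falling x′ k * fromℕ (suc n) * fromℕ (n !)
      ≈⟨ *-assoc _ _ _ ⟩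
    falling x′ k * (fromℕ (suc n) * fromℕ (n !))
      ≈⟨ *-congˡ (fromℕ-* (suc n) (n !)) ⟨
    falling x′ k * fromℕ (suc n !)
      ≈⟨ falling-! k (suc n) ⟩
    fromℕ ((k ℕ.+ suc n) !)
      ≈⟨ fromℕ-cong (≡.cong _! shift-suc) ⟨
    fromℕ ((suc k ℕ.+ n) !)
      ∎
    where
    shift-suc : suc k ℕ.+ n ≡ k ℕ.+ suc n
    shift-suc = ≡.sym (ℕₚ.+-suc k n)
    x x′ : Carrier
    x  = fromℕ (suc k ℕ.+ n)
    x′ = fromℕ (k ℕ.+ suc n)

  -- Powers expanded in falling factorials.

  ∑S₂-falling : Carrier → ℕ → ℕ → Carrier
  ∑S₂-falling z n i = sum {n} λ k → fromℕ (S₂ i (toℕ k)) * falling z (toℕ k)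

  -- The recurrence of S₂ combined with z (z)ₖ = (z)ₖ₊₁ + k (z)ₖ. The last term is the boundary term
  -- caused by truncating the sum.
  ∑S₂-falling-suc : ∀ z n i → ∑S₂-falling z (suc n) (suc i) ≈
    z * ∑S₂-falling z n i + fromℕ n * fromℕ (S₂ i n) * falling z n
  ∑S₂-falling-suc z zero i = +-cong
    (trans (*-congʳ fromℕ-0) (trans (zeroˡ _) (sym (zeroʳ z))))
    (sym (trans (*-congʳ (trans (*-congʳ fromℕ-0) (zeroˡ _))) (zeroˡ _)))
  ∑S₂-falling-suc z (suc n) i = begin
    ∑S₂-falling z (suc (suc n)) (suc i)
      ≈⟨ sum-snoc (suc n) (λ k → fromℕ (S₂ (suc i) k) * falling z k) ⟩
    ∑S₂-falling z (suc n) (suc i) + fromℕ (S₂ (suc i) (suc n)) * falling z (suc n)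
      ≈⟨ +-cong (∑S₂-falling-suc z n i) (*-congʳ
           (trans (fromℕ-+ (suc n ℕ.* S₂ i (suc n)) (S₂ i n)) (+-congʳ (fromℕ-* (suc n) (S₂ i (suc n)))))) ⟩
    z * A + N * s * f + (N′ * s′ + s) * (f * w)
      -- The solver knows no subtraction, so z - n is passed as the variable w. The coefficient of
      -- S₂(i, n) (z)ₙ is collected as w + n, which is then replaced by z.
      ≈⟨ solve 7 (λ zA N s f N′ s′ w → zA :+ N :* s :* f :+ (N′ :* s′ :+ s) :* (f :* w)
           := zA :+ (w :+ N) :* (s :* f) :+ N′ :* s′ :* (f :* w)) refl (z * A) N s f N′ s′ w ⟩
    z * A + (w + N) * (s * f) + N′ * s′ * (f * w)
      ≈⟨ +-congʳ (+-congˡ (*-congʳ w+N≈z)) ⟩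
    z * A + z * (s * f) + N′ * s′ * (f * w)
      ≈⟨ +-congʳ (distribˡ z A (s * f)) ⟨
    z * (A + s * f) + N′ * s′ * (f * w)
      ≈⟨ +-congʳ (*-congˡ (sum-snoc n (λ k → fromℕ (S₂ i k) * falling z k))) ⟨
    z * ∑S₂-falling z (suc n) i + N′ * s′ * falling z (suc n)
      ∎
    where
    A N N′ s s′ f w : Carrier
    A  = ∑S₂-falling z n i
    N  = fromℕ n
    N′ = fromℕ (suc n)
    s  = fromℕ (S₂ i n)
    s′ = fromℕ (S₂ i (suc n))
    f  = falling z n
    w  = z - N
    w+N≈z : w + N ≈ z
    w+N≈z = trans (+-assoc z (- N) N) (trans (+-congˡ (-‿inverseˡ N)) (+-identityʳ z))

  -- For i < n the truncation loses only zero terms, and the boundary term of `∑S₂-falling-suc`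
  -- disappears with S₂(i, n) = 0.
  ∑S₂-falling≈^ : ∀ z {n i} → i ℕ.< n → ∑S₂-falling z n i ≈ z ^ i
  ∑S₂-falling≈^ z {suc n} {zero} _ = trans
    (+-cong (trans (*-identityʳ _) fromℕ-1)
      (trans (sum-cong-≋ {n} λ k → trans (*-congʳ fromℕ-0) (zeroˡ (falling z (suc (toℕ k))))) (sum-replicate-zero n)))
    (+-identityʳ 1#)
  ∑S₂-falling≈^ z {suc n} {suc i} (s≤s i<n) = begin
    ∑S₂-falling z (suc n) (suc i)
      ≈⟨ ∑S₂-falling-suc z n i ⟩
    z * ∑S₂-falling z n i + fromℕ n * fromℕ (S₂ i n) * falling z n
      ≈⟨ +-cong (*-congˡ (∑S₂-falling≈^ z i<n))
           (trans (*-congʳ (trans (*-congˡ (trans (fromℕ-cong (S₂-zero i<n)) fromℕ-0)) (zeroʳ _))) (zeroˡ _)) ⟩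
    z * z ^ i + 0#
      ≈⟨ +-identityʳ _ ⟩
    z * z ^ i
      ∎

  -- The binomial series in eᵗ - 1.

  -- (1 + (eᵗ - 1))ᶻ = e^(zt)
  ∑-binom-[eᵗ-1]^ : ∀ z {n i} → i ℕ.≤ n →
    sum {suc n} (λ k → binom z (+ toℕ k) * (eᵗ-1 ^ˢ toℕ k) i) ≈ exp z i
  ∑-binom-[eᵗ-1]^ z {n} {i} i≤n = begin
    sum {suc n} (λ k → binom z (+ toℕ k) * (eᵗ-1 ^ˢ toℕ k) i)
      ≈⟨ sum-cong-≋ {suc n} (λ k → term (toℕ k)) ⟩
    sum {suc n} (λ k → fromℕ (S₂ i (toℕ k)) * falling z (toℕ k) * 1/ i !)
      ≈⟨ *-distribʳ-sum {suc n} (1/ i !) (λ k → fromℕ (S₂ i (toℕ k)) * falling z (toℕ k)) ⟨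
    ∑S₂-falling z (suc n) i * 1/ i !
      ≈⟨ *-congʳ (∑S₂-falling≈^ z (s≤s i≤n)) ⟩
    exp z i
      ∎
    where
    term : ∀ k → binom z (+ k) * (eᵗ-1 ^ˢ k) i ≈ fromℕ (S₂ i k) * falling z k * 1/ i !
    term k = begin
      f * 1/ k ! * u
        ≈⟨ *-identityʳ _ ⟨
      f * 1/ k ! * u * 1#
        ≈⟨ *-congˡ (n!*1/n! i) ⟨
      f * 1/ k ! * u * (fromℕ (i !) * 1/ i !)
        ≈⟨ solve 5 (λ f p u b q → f :* p :* u :* (b :* q) := f :* p :* (b :* u) :* q) refl f (1/ k !) u (fromℕ (i !)) (1/ i !) ⟩
      f * 1/ k ! * (fromℕ (i !) * u) * 1/ i !
        ≈⟨ *-congʳ (*-congˡ (n![eᵗ-1]^ i k)) ⟩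
      f * 1/ k ! * (fromℕ (k !) * s) * 1/ i !
        ≈⟨ solve 5 (λ f p a s q → f :* p :* (a :* s) :* q := a :* p :* (s :* f) :* q) refl f (1/ k !) (fromℕ (k !)) s (1/ i !) ⟩
      fromℕ (k !) * 1/ k ! * (s * f) * 1/ i !
        ≈⟨ *-congʳ (trans (*-congʳ (n!*1/n! k)) (*-identityˡ _)) ⟩
      s * f * 1/ i !
        ∎
      where
      f u s : Carrier
      f = falling z k
      u = (eᵗ-1 ^ˢ k) i
      s = fromℕ (S₂ i k)

  -- With k = n - j, multiplying by tᵏ moves the coefficient of tʲ to that of tⁿ, the same for all
  -- summands. Exchanging the sums leaves the binomial series at each index i ≤ n, where the terms k
  -- ≤ n suffice.
  ∑-binom-[eᵗ-1]/t^ : ∀ z g n →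
    sum {suc n} (λ j → binom z (+ (n ∸ toℕ j)) * ([eᵗ-1]/t ^ˢ (n ∸ toℕ j) ⊛ g) (toℕ j)) ≈ (exp z ⊛ g) n
  ∑-binom-[eᵗ-1]/t^ z g n = begin
    sum {suc n} (λ j → binom z (+ (n ∸ toℕ j)) * ([eᵗ-1]/t ^ˢ (n ∸ toℕ j) ⊛ g) (toℕ j))
      ≈⟨ sum-cong-≋ {suc n} (λ j → *-congˡ {binom z (+ (n ∸ toℕ j))} (to-eᵗ-1 j)) ⟩
    sum {suc n} (λ j → binom z (+ (n ∸ toℕ j)) * (eᵗ-1 ^ˢ (n ∸ toℕ j) ⊛ g) n)
      ≈⟨ sum-reverse n (λ k → binom z (+ k) * (eᵗ-1 ^ˢ k ⊛ g) n) ⟩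
    sum {suc n} (λ k → binom z (+ toℕ k) * (eᵗ-1 ^ˢ toℕ k ⊛ g) n)
      ≈⟨ sum-cong-≋ {suc n} (λ k → trans
           (*-distribˡ-sum {suc n} (binom z (+ toℕ k)) (λ i → (eᵗ-1 ^ˢ toℕ k) (toℕ i) * g (n ∸ toℕ i)))
           (sum-cong-≋ {suc n} λ i → sym (*-assoc (binom z (+ toℕ k)) ((eᵗ-1 ^ˢ toℕ k) (toℕ i)) (g (n ∸ toℕ i))))) ⟩
    sum {suc n} (λ k → sum {suc n} λ i → binom z (+ toℕ k) * (eᵗ-1 ^ˢ toℕ k) (toℕ i) * g (n ∸ toℕ i))
      ≈⟨ ∑-comm {suc n} {suc n} (λ k i → binom z (+ toℕ k) * (eᵗ-1 ^ˢ toℕ k) (toℕ i) * g (n ∸ toℕ i)) ⟩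
    sum {suc n} (λ i → sum {suc n} λ k → binom z (+ toℕ k) * (eᵗ-1 ^ˢ toℕ k) (toℕ i) * g (n ∸ toℕ i))
      ≈⟨ sum-cong-≋ {suc n} (λ i → trans
           (sym (*-distribʳ-sum {suc n} (g (n ∸ toℕ i)) (λ k → binom z (+ toℕ k) * (eᵗ-1 ^ˢ toℕ k) (toℕ i))))
           (*-congʳ (∑-binom-[eᵗ-1]^ z {n} (Finₚ.toℕ≤pred[n] i)))) ⟩
    (exp z ⊛ g) n
      ∎
    where
    to-eᵗ-1 : ∀ (j : Fin (suc n)) →
      ([eᵗ-1]/t ^ˢ (n ∸ toℕ j) ⊛ g) (toℕ j) ≈ (eᵗ-1 ^ˢ (n ∸ toℕ j) ⊛ g) n
    to-eᵗ-1 j = trans (sym (shift-^ˢ-⊛ [eᵗ-1]/t (n ∸ toℕ j) g (toℕ j)))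
      (reflexive (≡.cong (eᵗ-1 ^ˢ (n ∸ toℕ j) ⊛ g) (ℕₚ.m∸n+n≡m (Finₚ.toℕ≤pred[n] j))))

  -- The summands of the formula.

  t/[eᵗ-1]^-_ : ∀ k → t/[eᵗ-1]^ (ℤ.- + k) ≡ [eᵗ-1]/t ^ˢ k
  -- Negation computes only after this split: exponent 0 lands in the nonnegative branch, where the
  -- power is `1ˢ` as well.
  t/[eᵗ-1]^- zero  = ≡.refl
  t/[eᵗ-1]^- suc k = ≡.refl

  binom-cong : ∀ {x y} → x ≈ y → ∀ i → binom x i ≈ binom y i
  binom-cong x≈y (+ k)      = *-congʳ (falling-cong x≈y k)
  binom-cong x≈y ℤ.-[1+ k ] = refl

  fromℕ-suc-1 : ∀ n → fromℕ (suc n) - 1# ≈ fromℕ n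
  fromℕ-suc-1 n = trans (+-congʳ (trans (fromℕ-+ 1 n) (+-congʳ fromℕ-1))) (x+y-x≈y 1# (fromℕ n))

  -- Here y stands for -an and x for an + 1, so that a enters only through the relation x = 1 - y.
  summand : Carrier → Carrier → ℕ → ℕ → ℕ → Carrier
  summand y x n m l =
      binom y (+ n ℤ.- + l)
    * falling (fromℕ n - 1#) (n ∸ l)
    * binom (fromℕ l - 1#) (+ m ℤ.- + 1)
    * B (l ∸ m) (+ l ℤ.- + m ℤ.- + n ℤ.+ + 1) x

  -- The second binomial coefficient has lower index -1, hence is `0#` by definition.
  summand-zero : ∀ y x n l → summand y x n 0 l ≈ 0#
  summand-zero y x n l = trans (*-congʳ (zeroʳ _)) (zeroˡ _)

  -- In these coordinates the subtractions evaluate to k, j, m and the order -(k + m). The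
  -- factorials collapse by (m + j)ₘ j! = (m + j)! and (n)ₖ (m + j)! = n!.
  summand-k+j : ∀ y x m k j → let n = m ℕ.+ (k ℕ.+ j) in
    summand y x (suc n) (suc m) (suc m ℕ.+ j) ≈
      fromℕ (n !) * 1/ m ! * (binom y (+ k) * ([eᵗ-1]/t ^ˢ (k ℕ.+ m) ⊛ exp x) j)
  summand-k+j y x m k j = begin
    summand y x (suc n) (suc m) (suc l)
      ≈⟨ *-cong (*-cong (*-cong
             (reflexive (≡.cong (binom y) n-l))
             (trans (reflexive (≡.cong (falling (fromℕ (suc n) - 1#)) n∸l)) (falling-cong (fromℕ-suc-1 n) k)))
             (binom-cong (fromℕ-suc-1 l) (+ m)))
           (reflexive (≡.cong₂ (λ i r → fromℕ (i !) * (r ⊛ exp x) i) (ℕₚ.m+n∸m≡n m j)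
             (≡.trans (≡.cong t/[eᵗ-1]^_ (order≡ m k j)) (t/[eᵗ-1]^- (k ℕ.+ m))))) ⟩
    b * F * (G * 1/ m !) * (fromℕ (j !) * X)
      ≈⟨ solve 6 (λ b F G v J X → b :* F :* (G :* v) :* (J :* X) := F :* (G :* J) :* v :* (b :* X))
           refl b F G (1/ m !) (fromℕ (j !)) X ⟩
    F * (G * fromℕ (j !)) * 1/ m ! * (b * X)
      ≈⟨ *-congʳ (*-congʳ (*-cong (falling-cong (fromℕ-cong n≡k+l) k) (falling-! m j))) ⟩
    falling (fromℕ (k ℕ.+ l)) k * fromℕ (l !) * 1/ m ! * (b * X)
      ≈⟨ *-congʳ (*-congʳ (trans (falling-! k l) (fromℕ-cong (≡.cong _! (≡.sym n≡k+l))))) ⟩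
    fromℕ (n !) * 1/ m ! * (b * X)
      ∎
    where
    l n : ℕ
    l = m ℕ.+ j
    n = m ℕ.+ (k ℕ.+ j)

    b F G X : Carrier
    b = binom y (+ k)
    F = falling (fromℕ n) k
    G = falling (fromℕ l) m
    X = ([eᵗ-1]/t ^ˢ (k ℕ.+ m) ⊛ exp x) j

    n≡k+l : n ≡ k ℕ.+ l
    n≡k+l = ≡.trans (≡.sym (ℕₚ.+-assoc m k j)) (≡.trans (≡.cong (ℕ._+ j) (ℕₚ.+-comm m k)) (ℕₚ.+-assoc k m j))

    n∸l : n ∸ l ≡ k
    n∸l = ≡.trans (≡.cong (_∸ l) n≡k+l) (ℕₚ.m+n∸n≡m k l)

    n-l : + suc n ℤ.- + suc l ≡ + k
    n-l = ≡.trans (ℤₚ.⊖-≥ (s≤s (ℕₚ.+-monoʳ-≤ m (ℕₚ.m≤n+m j k)))) (≡.cong +_ n∸l)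

  -- Splitting the power k + m, with k = N - j, isolates a factor that is the same for every j and
  -- can play the role of g in `∑-binom-[eᵗ-1]/t^`.
  summand-≤ : ∀ y x m {N j} → j ℕ.≤ N →
    summand y x (suc (m ℕ.+ N)) (suc m) (suc m ℕ.+ j) ≈
      fromℕ ((m ℕ.+ N) !) * 1/ m ! *
        (binom y (+ (N ∸ j)) * ([eᵗ-1]/t ^ˢ (N ∸ j) ⊛ ([eᵗ-1]/t ^ˢ m ⊛ exp x)) j)
  summand-≤ y x m {N} {j} j≤N = trans
    -- Only k + j is rewritten to N; the occurrences of k itself stay fixed as `N ∸ j`.
    (≡.subst (λ M → summand y x (suc (m ℕ.+ M)) (suc m) (suc m ℕ.+ j) ≈
        fromℕ ((m ℕ.+ M) !) * 1/ m ! * (binom y (+ k) * ([eᵗ-1]/t ^ˢ (k ℕ.+ m) ⊛ exp x) j))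
      (ℕₚ.m∸n+n≡m j≤N) (summand-k+j y x m k j))
    (*-congˡ (*-congˡ (trans (⊛-congʳ (exp x) (^ˢ-+ [eᵗ-1]/t k m) j)
      (⊛-assoc ([eᵗ-1]/t ^ˢ k) ([eᵗ-1]/t ^ˢ m) (exp x) j))))
    where
    k : ℕ
    k = N ∸ j

  -- Summation over l.

  ∑-summand : ∀ y x m N → x ≈ 1# - y →
    sum {suc N} (λ j → summand y x (suc (m ℕ.+ N)) (suc m) (suc m ℕ.+ toℕ j)) ≈
      fromℕ (S₂ (suc (m ℕ.+ N)) (suc m))
  ∑-summand y x m N x≈1-y = begin
    sum {suc N} (λ j → summand y x (suc (m ℕ.+ N)) (suc m) (suc m ℕ.+ toℕ j))
      ≈⟨ sum-cong-≋ {suc N} (λ j → summand-≤ y x m (Finₚ.toℕ≤pred[n] j)) ⟩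
    sum {suc N} (λ j → K * (binom y (+ (N ∸ toℕ j)) * (E ^ˢ (N ∸ toℕ j) ⊛ (E ^ˢ m ⊛ exp x)) (toℕ j)))
      ≈⟨ *-distribˡ-sum {suc N} K
           (λ j → binom y (+ (N ∸ toℕ j)) * (E ^ˢ (N ∸ toℕ j) ⊛ (E ^ˢ m ⊛ exp x)) (toℕ j)) ⟨
    K * sum {suc N} (λ j → binom y (+ (N ∸ toℕ j)) * (E ^ˢ (N ∸ toℕ j) ⊛ (E ^ˢ m ⊛ exp x)) (toℕ j))
      ≈⟨ *-congˡ (∑-binom-[eᵗ-1]/t^ y (E ^ˢ m ⊛ exp x) N) ⟩
    K * (exp y ⊛ (E ^ˢ m ⊛ exp x)) N
      ≈⟨ *-congˡ (f⊛gh≋g⊛fh (exp y) (E ^ˢ m) (exp x) N) ⟩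
    K * (E ^ˢ m ⊛ (exp y ⊛ exp x)) N
      -- The relation x = 1 - y enters here: the exponentials combine to eᵗ and y disappears.
      ≈⟨ *-congˡ (⊛-congˡ (E ^ˢ m) exp-y⊛exp-x N) ⟩
    K * (E ^ˢ m ⊛ exp 1#) N
      ≈⟨ *-congˡ (shift-^ˢ-⊛ E m (exp 1#) N) ⟨
    fromℕ ((m ℕ.+ N) !) * 1/ m ! * (eᵗ-1 ^ˢ m ⊛ exp 1#) (m ℕ.+ N)
      ≈⟨ xy∙z≈xz∙y _ _ _ ⟩
    fromℕ ((m ℕ.+ N) !) * (eᵗ-1 ^ˢ m ⊛ exp 1#) (m ℕ.+ N) * 1/ m !
      ≈⟨ *-congʳ (n![eᵗ-1]^⊛eᵗ (m ℕ.+ N) m) ⟩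
    fromℕ (m !) * fromℕ (S₂ (suc (m ℕ.+ N)) (suc m)) * 1/ m !
      ≈⟨ xy∙z≈xz∙y _ _ _ ⟩
    fromℕ (m !) * 1/ m ! * fromℕ (S₂ (suc (m ℕ.+ N)) (suc m))
      ≈⟨ trans (*-congʳ (n!*1/n! m)) (*-identityˡ _) ⟩
    fromℕ (S₂ (suc (m ℕ.+ N)) (suc m))
      ∎
    where
    E : Series
    E = [eᵗ-1]/t

    K : Carrier
    K = fromℕ ((m ℕ.+ N) !) * 1/ m !

    y+x≈1 : y + x ≈ 1#
    y+x≈1 = trans (+-congˡ x≈1-y) (trans (sym (+-assoc y 1# (- y))) (x+y-x≈y y 1#))

    exp-cong : ∀ {z w} → z ≈ w → exp z ≋ exp w
    exp-cong z≈w n = *-congʳ (^-congˡ n z≈w)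

    exp-y⊛exp-x : exp y ⊛ exp x ≋ exp 1#
    exp-y⊛exp-x n = trans (exp-+ y x n) (exp-cong y+x≈1 n)

  stirling-bernoulli : ∀ y x n m → x ≈ 1# - y → 1 ℕ.≤ n →
    fromℕ (S₂ n m) ≈ ∑[ m ≤ l ≤ n ] summand y x n m l
  -- For m = 0 every summand vanishes, and S₂(n, 0) = 0 because n ≥ 1.
  stirling-bernoulli y x (suc n) zero x≈1-y _ = trans fromℕ-0 (sym (trans
    (sum-cong-≋ {suc (suc n)} λ i → summand-zero y x (suc n) (toℕ i))
    (sum-replicate-zero (suc (suc n)))))
  stirling-bernoulli y x (suc n) (suc m) x≈1-y _ with ℕₚ.≤-<-connex m n
  -- Writing n as m + N makes the number of terms N + 1. The truncated subtraction inside
  -- `sumFromTo` does not compute this, so `length≡` supplies it.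
  ... | inj₁ m≤n = ≡.subst (λ n → fromℕ (S₂ (suc n) (suc m)) ≈ ∑[ suc m ≤ l ≤ suc n ] summand y x (suc n) (suc m) l)
    (ℕₚ.m+[n∸m]≡n m≤n) (sym (trans (reflexive (≡.cong
      (λ k → sum {k} λ i → summand y x (suc (m ℕ.+ N)) (suc m) (suc m ℕ.+ toℕ i)) length≡))
      (∑-summand y x m N x≈1-y)))
    where
    N : ℕ
    N = n ∸ m
    length≡ : suc (m ℕ.+ N) ∸ m ≡ suc N
    length≡ = ≡.trans (≡.cong (_∸ m) (≡.sym (ℕₚ.+-suc m N))) (ℕₚ.m+n∸m≡n m (suc N))
  -- The sum is empty and the Stirling number is 0.
  ... | inj₂ n<m = trans (trans (fromℕ-cong (S₂-zero (s≤s n<m))) fromℕ-0) (sym (reflexive (≡.cong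
    (λ k → sum {k} λ i → summand y x (suc n) (suc m) (suc m ℕ.+ toℕ i)) (ℕₚ.m≤n⇒m∸n≡0 n<m))))

-- Specialisation to the complex numbers.

open CommutativeRing ℂ-commutativeRing using (_≈_; _+_; _*_; _-_; -_; 0#; 1#)
open BernoulliPolynomials ℂ-commutativeRing ℚ⇒ℂ

theorem11 : (a : ℂ) → ¬ (a ≈ 0#) → (n m : ℕ) → 1 ≤ℕ n →
    fromℕ (S₂ n m) ≈
      ∑[ m ≤ l ≤ n ]
        ( binom (- a * fromℕ n) (+ n ℤ.- + l)
        * falling (fromℕ n - 1#) (n ∸ l)
        * binom (fromℕ l - 1#) (+ m ℤ.- + 1)
        * B (l ∸ m) (+ l ℤ.- + m ℤ.- + n ℤ.+ + 1) (a * fromℕ n + 1#) )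
theorem11 a _ n m = stirling-bernoulli (- a * fromℕ n) (a * fromℕ n + 1#) n m x≈1-y
  where
  open StirlingBernoulli ℂ-commutativeRing ℚ⇒ℂ ℚ⇒ℂ-isRingHomomorphism using (stirling-bernoulli)
  open CommutativeRing ℂ-commutativeRing using (ring; trans; sym; +-comm; +-congˡ; -‿cong)
  open import Algebra.Properties.Ring ring using (-‿involutive; -‿distribˡ-*)

  x≈1-y : a * fromℕ n + 1# ≈ 1# - (- a * fromℕ n)
  x≈1-y = trans (+-comm (a * fromℕ n) 1#) (+-congˡ
    (sym (trans (-‿cong (sym (-‿distribˡ-* a (fromℕ n)))) (-‿involutive (a * fromℕ n)))))
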